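{- Let $\kappa$ be a regular uncountable cardinal and suppose $\mathrm{P}_{14}(\kappa,\sqsubseteq,1,\{\kappa\})$ holds. Then there exists a downward-closed subtree $T\subseteq{}^{<\kappa}\kappa$ which, ordered by proper inclusion, is a prolific slim $\kappa$-Souslin tree admitting an injective $\mathcal F^{\mathrm{fin}}_{\aleph_0}$-ascent path.
   Context: For a downward-closed $T\subseteq{}^{<\kappa}\kappa$ ordered by $\subsetneq$, the height of $t$ is $\mathrm{dom}(t)$ and $T_\alpha=T\cap{}^\alpha\kappa$. $T$ is prolific if for every $\alpha<\kappa$ and $x\in T_\alpha$, $x^\frown\langle i\rangle\in T$ for all $i<\max\{\omega,\alpha\}$; slim if $|T_\alpha|\le\max\{|\alpha|,\aleph_0\}$ for all $\alpha$; $\kappa$-Souslin if it has height $\kappa$, levels of size $<\kappa$, no cofinal branch and no antichain of size $\kappa$. $\mathcal F^{\mathrm{fin}}_{\aleph_0}=\{Z\subseteq\omega\mid\omega\setminus Z$ finite$\}$. An $\mathcal F^{\mathrm{fin}}_{\aleph_0}$-ascent path is $\langle f_\alpha\mid\alpha<\kappa\rangle$ with $f_\alpha:\omega\to T_\alpha$ and $\{n\mid f_\alpha(n)\subsetneq f_\beta(n)\}\in\mathcal F^{\mathrm{fin}}_{\aleph_0}$ for $\alpha<\beta<\kappa$; it is injective if some $f_\alpha\restriction I$ is injective with $I\in\mathcal F^{\mathrm{fin}}_{\aleph_0}$. Proxy principle: $\mathrm{acc}(D)=\{\alpha\in D\mid\sup(D\cap\alpha)=\alpha>0\}$, $\mathrm{succ}_\omega(D)=\{\delta\in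 D\mid0<\mathrm{otp}(D\cap\delta)<\omega\}$; $D\sqsubseteq C$ iff $D=C\cap\beta$ for some $\beta$. $\mathrm{P}^-_{14}(\kappa,\mathcal R,\mu,\mathcal S)$ (for a binary relation $\mathcal R$, cardinal $1\le\mu\le\kappa$, nonempty family $\mathcal S$ of stationary subsets of $\kappa$) asserts the existence of $\langle C_\alpha\mid\alpha<\kappa\rangle$ with: $C_\alpha$ club in $\alpha$ for limit $\alpha$; $C_{\bar\alpha}\mathrel{\mathcal R}C_\alpha$ whenever $\bar\alpha\in\mathrm{acc}(C_\alpha)$; for every sequence $\langle A_i\mid i<\mu\rangle$ of cofinal subsets of $\kappa$ and $S\in\mathcal S$, stationarily many $\alpha\in S$ satisfy $\sup\{\beta\in C_\alpha\mid\mathrm{succ}_\omega(C_\alpha\setminus\beta)\subseteq A_i\}=\alpha$ for all $i<\min\{\alpha,\mu\}$. $\mathrm{P}_{14}(\kappa,\mathcal R,\mu,\mathcal S)$ means $\mathrm{P}^-_{14}(\kappa,\mathcal R,\mu,\mathcal S)$ together with $\diamondsuit(\kappa)$. -}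

module Defs where

open import Data.Fin.Base as Fin using (Fin)
open import Data.List.Base using (List)
open import Data.List.Membership.Propositional using () renaming (_∈_ to _∈ₗ_)
open import Data.Nat.Base as ℕ using (ℕ)
open import Data.Product.Base using (Σ; Σ-syntax; ∃; ∃-syntax; _×_; _,_; proj₁; proj₂; swap; zip)
open import Data.Sum.Base using (_⊎_)
open import Function.Base using (_∘_; id)
open import Function.Bundles using (Injection; Bijection)
open import Induction.WellFounded using (WellFounded)
open import Level using (Level; _⊔_; suc)
open import Relation.Binary.Bundles using (Setoid)
open import Relation.Binary.Core using (Rel; _Preserves_⟶_)
import Relation.Binary.Construct.On as On
import Relation.Binary.Construct.StrictToNonStrict as StrictToNonStrict
open import Relation.Binary.PropositionalEquality using (_≡_; setoid)
open import Relation.Binary.Structures using (IsStrictTotalOrder)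
open import Relation.Nullary using (¬_)
open import Relation.Unary
  using (Pred; _∈_; _⊆_; _⊂_; _≐_; _∩_; _∪_; _∖_; ∁; Satisfiable)
open import Relation.Unary.Polymorphic using (U)

-- Sets are rendered as types or as predicates, and equality of subsets is
-- mutual inclusion _≐_.

private
  variable
    a b ℓ p q r s : Level

------------------------------------------------------------------------
-- Cardinality

-- Elements of a subset are compared by their underlying element only, so
-- that cardinality does not count proofs of membership.
Subset : (X : Setoid a b) → Pred (Setoid.Carrier X) p → Setoid (a ⊔ p) b
Subset X A = On.setoid {B = Σ (Setoid.Carrier X) A} X proj₁

infix 4 _≲_ _≺_ _≋_

_≲_ _≺_ _≋_ : Setoid a b → Setoid p q → Set (a ⊔ b ⊔ p ⊔ q)
X ≲ Y = Injection X Y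
X ≺ Y = X ≲ Y × ¬ (Y ≲ X)
X ≋ Y = Bijection X Y

Finite : Pred ℕ p → Set p
Finite Z = ∃[ ns ] (∀ n → n ∈ Z → n ∈ₗ ns)

𝓕-fin : Pred (Pred ℕ p) p
𝓕-fin Z = Finite (∁ Z)

------------------------------------------------------------------------
-- Regular uncountable cardinals

-- κ is given as the well-ordered type of its elements, the ordinals below it.
record RegularUncountableCardinal ℓ : Set (suc ℓ) where
  infix 4 _<_
  field
    Ord                : Set ℓ
    _<_                : Rel Ord ℓ
    isStrictTotalOrder : IsStrictTotalOrder _≡_ _<_
    <-wellFounded      : WellFounded _<_

  open StrictToNonStrict _≡_ _<_ public using (_≤_)

  -- The von Neumann ordinal α, as a subset of κ.
  ↓ : Ord → Pred Ord ℓ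
  ↓ α ξ = ξ < α

  field
    cardinal    : ∀ α → Subset (setoid Ord) (↓ α) ≺ setoid Ord
    uncountable : setoid ℕ ≺ setoid Ord
    -- No function from some α < κ is cofinal in κ; the values of f
    -- outside α play no role.
    regular     : ∀ α (f : Ord → Ord) → ∃[ β ] (∀ ξ → ξ < α → f ξ < β)

-- In what follows an ordinal ≤ κ is represented by an initial segment of κ:
-- ↓ α represents α < κ, and U represents κ itself.

module _ (κ : RegularUncountableCardinal ℓ) where
  open RegularUncountableCardinal κ

  InitialSegment : Pred (Pred Ord ℓ) ℓ
  InitialSegment δ = ∀ ξ η → ξ < η → η ∈ δ → ξ ∈ δ

  -- The cardinal 1 = {0}.
  𝟏 : Pred Ord ℓ
  𝟏 ξ = ∀ η → ¬ (η < ξ)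

  IsSup : Pred Ord ℓ → Ord → Set ℓ
  IsSup D α = (∀ ξ → ξ ∈ D → ξ ≤ α) × (∀ β → (∀ ξ → ξ ∈ D → ξ ≤ β) → α ≤ β)

  -- otp D = n, witnessed by the increasing enumeration of D.
  HasOrderType : Pred Ord ℓ → ℕ → Set ℓ
  HasOrderType D n =
    Σ[ e ∈ (Fin n → Ord) ]
      (e Preserves Fin._<_ ⟶ _<_) × D ≐ (λ ξ → ∃[ i ] e i ≡ ξ)

  ω : Pred Ord ℓ
  ω ξ = ∃[ n ] HasOrderType (↓ ξ) n

  Limit : Pred Ord ℓ
  Limit α = Satisfiable (↓ α) × IsSup (↓ α) α

  acc : Pred Ord ℓ → Pred Ord ℓ
  acc D α = α ∈ D × IsSup (D ∩ ↓ α) α × Satisfiable (↓ α)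

  succ-ω : Pred Ord ℓ → Pred Ord ℓ
  succ-ω D δ = δ ∈ D × ∃[ n ] (0 ℕ.< n × HasOrderType (D ∩ ↓ δ) n)

  -- D is cofinal in the limit ordinal δ ≤ κ.
  CofinalIn : Pred Ord ℓ → Pred Ord ℓ → Set ℓ
  CofinalIn δ D = D ⊆ δ × (∀ β → β ∈ δ → ∃[ γ ] (γ ∈ D × β ≤ γ))

  ClubIn : Pred Ord ℓ → Pred Ord ℓ → Set ℓ
  ClubIn δ D =
    CofinalIn δ D ×
    (∀ β → β ∈ δ → Satisfiable (↓ β) → IsSup (D ∩ ↓ β) β → β ∈ D)

  Stationary : Pred (Pred Ord ℓ) (suc ℓ)
  Stationary S = ∀ D → ClubIn U D → Satisfiable (S ∩ D)

  ----------------------------------------------------------------------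
  -- The proxy principle

  -- D ⊑ C iff D = C ∩ β for some ordinal β; as D, C ⊆ κ, only β ≤ κ matter.
  _⊑_ : Rel (Pred Ord ℓ) (suc ℓ)
  D ⊑ C = ∃[ β ] (InitialSegment β × D ≐ C ∩ β)

  -- The parameters are meant to range over cardinals 1 ≤ μ ≤ κ and nonempty
  -- families 𝓢 of stationary sets.  Only the values of A at i < μ matter.
  P⁻₁₄ : Rel (Pred Ord ℓ) r → Pred Ord ℓ → Pred (Pred Ord ℓ) s →
         Set (suc ℓ ⊔ r ⊔ s)
  P⁻₁₄ _𝓡_ μ 𝓢 =
    Σ[ C ∈ (Ord → Pred Ord ℓ) ]
      (∀ α → Limit α → ClubIn (↓ α) (C α)) ×
      (∀ α ᾱ → ᾱ ∈ acc (C α) → C ᾱ 𝓡 C α) ×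
      (∀ (A : Ord → Pred Ord ℓ) → (∀ i → i ∈ μ → CofinalIn U (A i)) →
       ∀ S → S ∈ 𝓢 →
       Stationary (S ∩ λ α → ∀ i → i ∈ ↓ α ∩ μ →
         IsSup (λ β → β ∈ C α × succ-ω (C α ∖ ↓ β) ⊆ A i) α))

  ◇ : Set (suc ℓ)
  ◇ = Σ[ Z ∈ (Ord → Pred Ord ℓ) ]
        (∀ α → Z α ⊆ ↓ α) ×
        (∀ (A : Pred Ord ℓ) → Stationary (λ α → A ∩ ↓ α ≐ Z α))

  P₁₄ : Rel (Pred Ord ℓ) r → Pred Ord ℓ → Pred (Pred Ord ℓ) s →
        Set (suc ℓ ⊔ r ⊔ s)
  P₁₄ _𝓡_ μ 𝓢 = P⁻₁₄ _𝓡_ μ 𝓢 × ◇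

  -- The family {κ}.
  ｛κ｝ : Pred (Pred Ord ℓ) ℓ
  ｛κ｝ S = S ≐ U {ℓ = ℓ}

  ----------------------------------------------------------------------
  -- Subtrees of ^{<κ}κ

  -- Irrelevance of the domain proof makes the value depend on ξ alone.
  record Seq : Set ℓ where
    field
      dom : Ord
      val : (ξ : Ord) → .(ξ < dom) → Ord

  open Seq

  Graph : Seq → Pred (Ord × Ord) ℓ
  Graph t (ξ , η) = Σ[ ξ<dom ∈ ξ < dom t ] val t ξ ξ<dom ≡ η

  infix 4 _≈ₛ_ _⊊_

  _≈ₛ_ _⊊_ : Rel Seq ℓ
  s ≈ₛ t = Graph s ≐ Graph t
  s ⊊ t = Graph s ⊂ Graph t

  Seqₛ : Setoid ℓ ℓ
  Seqₛ = record
    { Carrier       = Seq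
    ; _≈_           = _≈ₛ_
    ; isEquivalence = record
      { refl  = id , id
      ; sym   = swap
      ; trans = zip (λ f g → g ∘ f) (λ f g → f ∘ g)
      }
    }

  -- In particular T is closed under _≈ₛ_.
  DownwardClosed : Pred (Pred Seq ℓ) ℓ
  DownwardClosed T = ∀ s t → Graph s ⊆ Graph t → t ∈ T → s ∈ T

  LevelOf : Pred Seq ℓ → Ord → Pred Seq ℓ
  LevelOf T α = T ∩ (λ t → dom t ≡ α)

  -- s = x⌢⟨i⟩
  IsSnoc : Seq → Seq → Ord → Set ℓ
  IsSnoc s x i = Graph s ≐ Graph x ∪ (_≡ (dom x , i))

  -- max{ω,α} is the union of ω and α.
  Prolific : Pred (Pred Seq ℓ) ℓ
  Prolific T = ∀ α x → x ∈ LevelOf T α → ∀ i → i ∈ ω ∪ ↓ α →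
               ∃[ s ] (IsSnoc s x i × s ∈ T)

  Slim : Pred (Pred Seq ℓ) ℓ
  Slim T = ∀ α → (Subset Seqₛ (LevelOf T α) ≲ Subset (setoid Ord) (↓ α))
               ⊎ (Subset Seqₛ (LevelOf T α) ≲ setoid ℕ)

  CofinalBranch : Pred Seq ℓ → Pred Seq ℓ → Set ℓ
  CofinalBranch T B =
    B ⊆ T ×
    (∀ s t → s ∈ B → t ∈ B → s ⊊ t ⊎ s ≈ₛ t ⊎ t ⊊ s) ×
    (∀ α → Satisfiable (LevelOf B α))

  Antichain : Pred Seq ℓ → Pred Seq ℓ → Set ℓ
  Antichain T A =
    A ⊆ T × (∀ s t → s ∈ A → t ∈ A → ¬ (s ≈ₛ t) → ¬ (s ⊊ t) × ¬ (t ⊊ s))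

  -- Every node has height below κ, so T has height κ iff no level is empty.
  record Souslin (T : Pred Seq ℓ) : Set (suc ℓ) where
    field
      height-κ          : ∀ α → Satisfiable (LevelOf T α)
      small-levels      : ∀ α → Subset Seqₛ (LevelOf T α) ≺ setoid Ord
      no-cofinal-branch : ∀ B → ¬ CofinalBranch T B
      no-κ-antichain    : ∀ A → Antichain T A → ¬ (Subset Seqₛ A ≋ setoid Ord)

  AscentPath : Pred (Pred ℕ ℓ) ℓ → Pred Seq ℓ → (Ord → ℕ → Seq) → Set ℓ
  AscentPath 𝓕 T f =
    (∀ α n → f α n ∈ LevelOf T α) ×
    (∀ α β → α < β → (λ n → f α n ⊊ f β n) ∈ 𝓕)

  InjectivePath : Pred (Pred ℕ ℓ) ℓ → (Ord → ℕ → Seq) → Set (suc ℓ)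
  InjectivePath 𝓕 f =
    ∃[ α ] ∃[ I ] (I ∈ 𝓕 × (∀ m n → m ∈ I → n ∈ I → f α m ≈ₛ f α n → m ≡ n))

{-# OPTIONS --safe #-}
module Submission where

open import Defs
open import Axiom.ExcludedMiddle using (ExcludedMiddle)
open import Data.Empty using (⊥-elim)
import Data.Empty.Polymorphic as Poly
open import Data.Fin.Base as Fin using (Fin)
import Data.Fin.Properties as Fin
open import Data.List.Base using ([]; upTo)
open import Data.List.Membership.Propositional.Properties using (∈-upTo⁺)
open import Data.Nat.Base as ℕ using (ℕ)
import Data.Nat.Properties as ℕ
open import Data.Product.Base using (Σ-syntax; ∃-syntax; _×_; _,_; proj₁; proj₂; swap)
open import Data.Product.Relation.Binary.Lex.Strict using (×-Lex; ×-wellFounded)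
open import Data.Sum.Base using (_⊎_; inj₁; inj₂)
import Data.Unit.Polymorphic as Poly
open import Function.Base using (_∘_; _on_)
open import Function.Bundles using (module Injection; module Bijection)
open import Induction.WellFounded using (WellFounded; Acc; acc; module All)
open import Level using (Level; _⊔_)
open import Relation.Binary.Bundles using (Setoid)
open import Relation.Binary.Core using (Rel)
import Relation.Binary.Construct.On as On
open import Relation.Binary.Definitions using (tri<; tri≈; tri>)
open import Relation.Binary.PropositionalEquality
  using (_≡_; _≢_; refl; sym; trans; cong; cong₂; subst; setoid)
open import Relation.Binary.Structures using (IsStrictTotalOrder)
open import Relation.Nullary using (¬_; Dec; yes; no)
open import Relation.Unary using (Pred; _∈_; _⊆_; _≐_; _∩_; _∪_; _∖_; Satisfiable)
open import Relation.Unary.Polymorphic using (U)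

-- The levels are built by recursion.  Successor levels add every admissible
-- value.  At a limit α, each earlier node x is continued to a branch along C α,
-- and so is each entry of the ascent path; since C γ = C α ∩ γ at accumulation
-- points γ of C α, the part of such a branch below γ is already a node, so the
-- branches never break off.  At every other γ ∈ C α a branch chooses, if it can,
-- a node above some element of the set guessed by Z γ.  Only the branch for the
-- n-th entry of the ascent path follows that path instead, and only during the
-- first n steps after an accumulation point: each step thus leaves all but
-- finitely many entries on the path, while every entry is sealed at almost all
-- steps of every block of ω consecutive elements of C α.  Hence for every
-- predense D there is a level α all of whose nodes extend an element of D.  This
-- bounds antichains and, as nodes off a chain are predense, excludes branches.

-- Every choice takes the least available index. The choices at an element γ of `C α` therefore
-- depend only on `C α` below γ and on the levels and guesses up to γ, and so coherence of the clubs
-- becomes agreement of the branches below accumulation points. Slimness forbids adding all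
-- branches: one for each earlier node and one for each natural number keeps a limit level α at size
-- at most `|α| · |α|`, which is why pairing functions on infinite ordinals are needed. The guesses
-- are consulted at points of `C α`, not at α itself: the levels that guess a given predense set
-- correctly, and are closed under finding comparable elements of it, form a cofinal set, and to
-- this set the proxy principle is applied. A single step would not seal all entries of the ascent
-- path at once, since those with large n still follow the path there.

-- Order and recursion on the ordinals below `κ`.

module Ordinals
  (em : ∀ {a} → ExcludedMiddle a) {ℓ : Level} (κ : RegularUncountableCardinal ℓ) where

  open RegularUncountableCardinal κ public

  by-contradiction : ∀ {p} {P : Set p} → ¬ ¬ P → P
  by-contradiction {P = P} ¬¬p with em {P = P}
  ... | yes p = p
  ... | no ¬p = ⊥-elim (¬¬p ¬p)

  <-induction : ∀ {p} (P : Pred Ord p) → (∀ α → (∀ β → β < α → P β) → P α) → ∀ α → P α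
  <-induction P step = All.wfRec <-wellFounded _ P (λ α ih → step α (λ β β<α → ih β<α))

  open IsStrictTotalOrder isStrictTotalOrder public
    using (compare) renaming (trans to <-trans)

  <-irrefl : ∀ {α} → ¬ (α < α)
  <-irrefl = IsStrictTotalOrder.irrefl isStrictTotalOrder refl

  <⇒≢ : ∀ {α β} → α < β → α ≢ β
  <⇒≢ α<β refl = <-irrefl α<β

  ≤-refl : ∀ {α} → α ≤ α
  ≤-refl = inj₂ refl

  <-≤-trans : ∀ {α β γ} → α < β → β ≤ γ → α < γ
  <-≤-trans α<β (inj₁ β<γ)  = <-trans α<β β<γ
  <-≤-trans α<β (inj₂ refl) = α<β

  ≤-<-trans : ∀ {α β γ} → α ≤ β → β < γ → α < γ
  ≤-<-trans (inj₁ α<β)  β<γ = <-trans α<β β<γ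
  ≤-<-trans (inj₂ refl) β<γ = β<γ

  ≤-trans : ∀ {α β γ} → α ≤ β → β ≤ γ → α ≤ γ
  ≤-trans (inj₁ α<β)  β≤γ = inj₁ (<-≤-trans α<β β≤γ)
  ≤-trans (inj₂ refl) β≤γ = β≤γ

  ≮⇒≥ : ∀ {α β} → ¬ (α < β) → β ≤ α
  ≮⇒≥ {α} {β} α≮β with compare α β
  ... | tri< α<β _ _ = ⊥-elim (α≮β α<β)
  ... | tri≈ _ α≡β _ = inj₂ (sym α≡β)
  ... | tri> _ _ β<α = inj₁ β<α

  ≤⇒≯ : ∀ {α β} → α ≤ β → ¬ (β < α)
  ≤⇒≯ α≤β β<α = <-irrefl (≤-<-trans α≤β β<α)

  ≰⇒> : ∀ {α β} → ¬ (α ≤ β) → β < α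
  ≰⇒> α≰β = by-contradiction (λ β≮α → α≰β (≮⇒≥ β≮α))

  ≤-antisym : ∀ {α β} → α ≤ β → β ≤ α → α ≡ β
  ≤-antisym (inj₂ α≡β) _   = α≡β
  ≤-antisym (inj₁ α<β) β≤α = ⊥-elim (≤⇒≯ β≤α α<β)

  <-≤-dec : ∀ α β → α < β ⊎ β ≤ α
  <-≤-dec α β with compare α β
  ... | tri< α<β _ _ = inj₁ α<β
  ... | tri≈ _ α≡β _ = inj₂ (inj₂ (sym α≡β))
  ... | tri> _ _ β<α = inj₂ (inj₁ β<α)

  -- Least elements

  IsLeast : ∀ {p} → Pred Ord p → Ord → Set (p ⊔ ℓ)
  IsLeast P ξ = P ξ × (∀ η → P η → ξ ≤ η)

  least : ∀ {p} (P : Pred Ord p) → Satisfiable P → ∃[ ξ ] IsLeast P ξ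
  least P (ξ , pξ) = go ξ (<-wellFounded ξ) pξ
    where
    go : ∀ ξ → Acc _<_ ξ → P ξ → ∃[ η ] IsLeast P η
    go ξ (acc rs) pξ with em {P = ∃[ η ] (η < ξ × P η)}
    ... | yes (η , η<ξ , pη) = go η (rs η<ξ) pη
    ... | no none = ξ , pξ , λ η pη → ≮⇒≥ (λ η<ξ → none (η , η<ξ , pη))

  IsLeast-unique : ∀ {p q} {P : Pred Ord p} {Q : Pred Ord q} {ξ η} →
                   P ≐ Q → IsLeast P ξ → IsLeast Q η → ξ ≡ η
  IsLeast-unique (P⊆Q , Q⊆P) (pξ , ξ-min) (qη , η-min) =
    ≤-antisym (ξ-min _ (Q⊆P qη)) (η-min _ (P⊆Q pξ))

  private
    least-ordinal : ∃[ ξ ] IsLeast (λ ξ → ξ ≡ ξ) ξ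
    least-ordinal = least (λ ξ → ξ ≡ ξ) (Injection.to (proj₁ uncountable) 0 , refl)

  abstract
    zero : Ord
    zero = proj₁ least-ordinal

    zero-≤ : ∀ ξ → zero ≤ ξ
    zero-≤ ξ = proj₂ (proj₂ least-ordinal) ξ refl

  ≮zero : ∀ {ξ} → ¬ (ξ < zero)
  ≮zero ξ<0 = ≤⇒≯ (zero-≤ _) ξ<0

  abstract
    -- If P is empty, then μ P = zero.
    μ : ∀ {p} → Pred Ord p → Ord
    μ P with em {P = Satisfiable P}
    ... | yes p = proj₁ (least P p)
    ... | no  _ = zero

    μ-least : ∀ {p} (P : Pred Ord p) → Satisfiable P → IsLeast P (μ P)
    μ-least P p with em {P = Satisfiable P}
    ... | yes p′ = proj₂ (least P p′)
    ... | no  ¬p = ⊥-elim (¬p p)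

    μ-∈-or-zero : ∀ {p} (P : Pred Ord p) → P (μ P) ⊎ μ P ≡ zero
    μ-∈-or-zero P with em {P = Satisfiable P}
    ... | yes p = inj₁ (proj₁ (proj₂ (least P p)))
    ... | no  _ = inj₂ refl

    μ-cong : ∀ {p q} {P : Pred Ord p} {Q : Pred Ord q} → P ≐ Q → μ P ≡ μ Q
    μ-cong {P = P} {Q} P≐Q@(P⊆Q , Q⊆P) with em {P = Satisfiable P} | em {P = Satisfiable Q}
    ... | yes p       | yes q       = IsLeast-unique P≐Q (proj₂ (least P p)) (proj₂ (least Q q))
    ... | yes (ξ , p) | no ¬q       = ⊥-elim (¬q (ξ , P⊆Q p))
    ... | no ¬p       | yes (ξ , q) = ⊥-elim (¬p (ξ , Q⊆P q))
    ... | no _        | no _        = refl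

  μ-∈ : ∀ {p} (P : Pred Ord p) → Satisfiable P → P (μ P)
  μ-∈ P p = proj₁ (μ-least P p)

  μ-≤ : ∀ {p} (P : Pred Ord p) {ξ} → P ξ → μ P ≤ ξ
  μ-≤ P {ξ} pξ = proj₂ (μ-least P (ξ , pξ)) ξ pξ

  -- Recursive choice of least ordinals

  module LeastChoice {x} {X : Set x} {_≺_ : Rel X ℓ} (wf : WellFounded _≺_) where

    AgreeBelow : X → (f g : X → Ord) → Set (x ⊔ ℓ)
    AgreeBelow a f g = ∀ b → b ≺ a → f b ≡ g b

    -- In the absence of function extensionality, quantifying over the total
    -- extensions g of the values below a makes the result independent of the
    -- accessibility proof.
    private
      choose′ : ∀ {p} (Φ : X → (X → Ord) → Pred Ord p) → ∀ a → Acc _≺_ a → Ord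
      choose′ Φ a (acc rs) =
        μ (λ i → ∃[ g ] ((∀ b (b≺a : b ≺ a) → g b ≡ choose′ Φ b (rs b≺a)) × Φ a g i))

      choose′-irrelevant : ∀ {p} (Φ : X → (X → Ord) → Pred Ord p) a (r r′ : Acc _≺_ a) →
                           choose′ Φ a r ≡ choose′ Φ a r′
      choose′-irrelevant Φ a (acc rs) (acc rs′) = μ-cong
        ( (λ (g , g≡ , φ) → g , (λ b b≺a → trans (g≡ b b≺a) (eq b≺a)) , φ)
        , (λ (g , g≡ , φ) → g , (λ b b≺a → trans (g≡ b b≺a) (sym (eq b≺a))) , φ))
        where
        eq : ∀ {b} (b≺a : b ≺ a) → choose′ Φ b (rs b≺a) ≡ choose′ Φ b (rs′ b≺a)
        eq b≺a = choose′-irrelevant Φ _ (rs b≺a) (rs′ b≺a)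

    abstract
      choose : ∀ {p} (Φ : X → (X → Ord) → Pred Ord p) → X → Ord
      choose Φ a = choose′ Φ a (wf a)

      choose-unfold : ∀ {p} (Φ : X → (X → Ord) → Pred Ord p) a →
        choose Φ a ≡ μ (λ i → ∃[ g ] (AgreeBelow a g (choose Φ) × Φ a g i))
      choose-unfold Φ a with wf a
      ... | acc rs = μ-cong
        ( (λ (g , g≡ , φ) → g , (λ b b≺a → trans (g≡ b b≺a) (choose′-irrelevant Φ b (rs b≺a) (wf b))) , φ)
        , (λ (g , g≡ , φ) → g , (λ b b≺a → trans (g≡ b b≺a) (choose′-irrelevant Φ b (wf b) (rs b≺a))) , φ))

    -- `Φ` is not assumed to respect pointwise equality of its function argument, hence the `g` that
    -- agrees with `choose Φ` only below `a`.
    choose-∈ : ∀ {p} (Φ : X → (X → Ord) → Pred Ord p) a → Satisfiable (Φ a (choose Φ)) →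
               ∃[ g ] (AgreeBelow a g (choose Φ) × Φ a g (choose Φ a))
    choose-∈ Φ a (i , φ) =
      subst (λ v → ∃[ g ] (AgreeBelow a g (choose Φ) × Φ a g v)) (sym (choose-unfold Φ a))
            (μ-∈ (λ i → ∃[ g ] (AgreeBelow a g (choose Φ) × Φ a g i)) (i , _ , (λ _ _ → refl) , φ))

    choose-≤ : ∀ {p} (Φ : X → (X → Ord) → Pred Ord p) a {i} → Φ a (choose Φ) i → choose Φ a ≤ i
    choose-≤ Φ a {i} φ =
      subst (_≤ i) (sym (choose-unfold Φ a))
            (μ-≤ (λ i → ∃[ g ] (AgreeBelow a g (choose Φ) × Φ a g i)) (_ , (λ _ _ → refl) , φ))

    choose-cong : ∀ {p q r} {Φ : X → (X → Ord) → Pred Ord p} {Ψ : X → (X → Ord) → Pred Ord q}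
      (I : Pred X r) → (∀ {a b} → b ≺ a → I a → I b) →
      (∀ a → I a → ∀ g → Φ a g ≐ Ψ a g) →
      ∀ a → I a → choose Φ a ≡ choose Ψ a
    choose-cong {Φ = Φ} {Ψ} I I-down Φ≐Ψ = All.wfRec wf _ (λ a → I a → choose Φ a ≡ choose Ψ a) step
      where
      step : ∀ a → (∀ {b} → b ≺ a → I b → choose Φ b ≡ choose Ψ b) → I a → choose Φ a ≡ choose Ψ a
      step a ih Ia = trans (choose-unfold Φ a) (trans (μ-cong
        ( (λ (g , g≡ , φ) → g , (λ b b≺a → trans (g≡ b b≺a) (ih b≺a (I-down b≺a Ia)))
                              , proj₁ (Φ≐Ψ a Ia g) φ)
        , (λ (g , g≡ , ψ) → g , (λ b b≺a → trans (g≡ b b≺a) (sym (ih b≺a (I-down b≺a Ia))))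
                              , proj₂ (Φ≐Ψ a Ia g) ψ)))
        (sym (choose-unfold Ψ a)))

  -- Successors, finite ordinals and maxima

  private
    nonzero : ∃[ α ] (zero < α)
    nonzero = go (zero-≤ (to 0)) (zero-≤ (to 1))
      where
      open Injection (proj₁ uncountable) using (to; injective)
      go : zero ≤ to 0 → zero ≤ to 1 → ∃[ α ] (zero < α)
      go (inj₁ 0<x) _          = _ , 0<x
      go (inj₂ _)   (inj₁ 0<y) = _ , 0<y
      go (inj₂ 0≡x) (inj₂ 0≡y) with injective (trans (sym 0≡x) 0≡y)
      ... | ()

  -- Regularity for the constant function `α`, on a nonempty domain `↓ δ`; an empty one would leave
  -- `β` unconstrained.
  unbounded : ∀ α → ∃[ β ] (α < β)
  unbounded α with nonzero
  ... | (δ , 0<δ) with regular δ (λ _ → α)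
  ... | (β , α<β) = β , α<β zero 0<δ

  next : Ord → Ord
  next α = μ (α <_)

  <-next : ∀ {α} → α < next α
  <-next {α} = μ-∈ (α <_) (unbounded α)

  next-≤ : ∀ {α β} → α < β → next α ≤ β
  next-≤ {α} α<β = μ-≤ (α <_) α<β

  <-next⇒≤ : ∀ {α β} → α < next β → α ≤ β
  <-next⇒≤ α<β+1 = ≮⇒≥ (λ β<α → ≤⇒≯ (next-≤ β<α) α<β+1)

  ≤⇒<-next : ∀ {α β} → α ≤ β → α < next β
  ≤⇒<-next α≤β = ≤-<-trans α≤β <-next

  next-injective : ∀ {α β} → next α ≡ next β → α ≡ β
  next-injective {α} {β} eq = ≤-antisym
    (<-next⇒≤ (subst (α <_) eq <-next)) (<-next⇒≤ (subst (β <_) (sym eq) <-next))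

  fin : ℕ → Ord
  fin 0         = zero
  fin (ℕ.suc n) = next (fin n)

  fin-mono : ∀ {m n} → m ℕ.< n → fin m < fin n
  fin-mono {m} {ℕ.suc n} (ℕ.s≤s m≤n) with ℕ.m≤n⇒m<n∨m≡n m≤n
  ... | inj₁ m<n  = <-trans (fin-mono m<n) <-next
  ... | inj₂ refl = <-next

  fin-injective : ∀ {m n} → fin m ≡ fin n → m ≡ n
  fin-injective {m} {n} eq with ℕ.<-cmp m n
  ... | tri< m<n _ _ = ⊥-elim (<⇒≢ (fin-mono m<n) eq)
  ... | tri≈ _ m≡n _ = m≡n
  ... | tri> _ _ n<m = ⊥-elim (<⇒≢ (fin-mono n<m) (sym eq))

  ≤fin⇒fin : ∀ {ξ} n → ξ ≤ fin n → ∃[ m ] (ξ ≡ fin m)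
  ≤fin⇒fin n         (inj₂ ξ≡n) = n , ξ≡n
  ≤fin⇒fin 0         (inj₁ ξ<0) = ⊥-elim (≮zero ξ<0)
  ≤fin⇒fin (ℕ.suc n) (inj₁ ξ<n) = ≤fin⇒fin n (<-next⇒≤ ξ<n)

  abstract
    -- The inverse of fin (0 on infinite ordinals).
    nat : Ord → ℕ
    nat ξ with em {P = ∃[ n ] (ξ ≡ fin n)}
    ... | yes (n , _) = n
    ... | no _        = 0

    fin-nat : ∀ {ξ} → ∃[ n ] (ξ ≡ fin n) → fin (nat ξ) ≡ ξ
    fin-nat {ξ} finite with em {P = ∃[ n ] (ξ ≡ fin n)}
    ... | yes (n , ξ≡n) = sym ξ≡n
    ... | no infinite   = ⊥-elim (infinite finite)

  nat-fin : ∀ n → nat (fin n) ≡ n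
  nat-fin n = fin-injective (fin-nat (n , refl))

  private
    -- Otherwise every ordinal is finite and `nat` injects `Ord` into ℕ, against uncountability.
    fin-bounded : ∃[ β ] (∀ n → fin n < β)
    fin-bounded = by-contradiction λ none → proj₂ uncountable (record
      { to        = nat
      ; cong      = cong nat
      ; injective = λ {ξ} {η} eq →
          trans (sym (fin-nat (finite none ξ))) (trans (cong fin eq) (fin-nat (finite none η)))
      })
      where
      finite : ¬ (∃[ β ] (∀ n → fin n < β)) → ∀ ξ → ∃[ n ] (ξ ≡ fin n)
      finite none ξ = by-contradiction λ infinite → none (ξ , λ n →
        ≰⇒> (λ ξ≤n → infinite (≤fin⇒fin n ξ≤n)))

  ω₀ : Ord
  ω₀ = μ (λ β → ∀ n → fin n < β)

  fin<ω₀ : ∀ n → fin n < ω₀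
  fin<ω₀ = μ-∈ (λ β → ∀ n → fin n < β) fin-bounded

  <ω₀⇒fin : ∀ {ξ} → ξ < ω₀ → ∃[ n ] (ξ ≡ fin n)
  <ω₀⇒fin {ξ} ξ<ω = by-contradiction λ infinite →
    ≤⇒≯ (μ-≤ (λ β → ∀ n → fin n < β) (λ n → ≰⇒> (λ ξ≤n → infinite (≤fin⇒fin n ξ≤n)))) ξ<ω

  -- If `ω₀ ≤ ξ`, the `n + 1` ordinals from `fin 0` to `fin n` lie below `ξ`, which has only `n`
  -- predecessors.
  ω⇒<ω₀ : ∀ {ξ} → ω κ ξ → ξ < ω₀
  ω⇒<ω₀ {ξ} (n , e , e-mono , ↓ξ⊆e , _) = ≰⇒> λ ω≤ξ → contra ω≤ξ
    where
    contra : ¬ (ω₀ ≤ ξ)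
    contra ω≤ξ with Fin.pigeonhole (ℕ.n<1+n n) index
      where
      index : Fin (ℕ.suc n) → Fin n
      index i = proj₁ (↓ξ⊆e (<-≤-trans (fin<ω₀ (Fin.toℕ i)) ω≤ξ))
    ... | i , j , i<j , eq = <⇒≢ (fin-mono i<j)
      (trans (sym (proj₂ (↓ξ⊆e (<-≤-trans (fin<ω₀ (Fin.toℕ i)) ω≤ξ))))
             (trans (cong e eq) (proj₂ (↓ξ⊆e (<-≤-trans (fin<ω₀ (Fin.toℕ j)) ω≤ξ)))))

  infixl 6 _⊔ₒ_
  abstract
    _⊔ₒ_ : Ord → Ord → Ord
    α ⊔ₒ β with <-≤-dec α β
    ... | inj₁ _ = β
    ... | inj₂ _ = α

    ≤-⊔ˡ : ∀ α β → α ≤ α ⊔ₒ β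
    ≤-⊔ˡ α β with <-≤-dec α β
    ... | inj₁ α<β = inj₁ α<β
    ... | inj₂ _   = ≤-refl

    ≤-⊔ʳ : ∀ α β → β ≤ α ⊔ₒ β
    ≤-⊔ʳ α β with <-≤-dec α β
    ... | inj₁ _   = ≤-refl
    ... | inj₂ β≤α = β≤α

    ⊔-lub : ∀ {α β γ} → α ≤ γ → β ≤ γ → α ⊔ₒ β ≤ γ
    ⊔-lub {α} {β} α≤γ β≤γ with <-≤-dec α β
    ... | inj₁ _ = β≤γ
    ... | inj₂ _ = α≤γ

    ⊔-lub-< : ∀ {α β γ} → α < γ → β < γ → α ⊔ₒ β < γ
    ⊔-lub-< {α} {β} α<γ β<γ with <-≤-dec α β
    ... | inj₁ _ = β<γ
    ... | inj₂ _ = α<γ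

  -- Closure points

  limit-of-next-closed : ∀ {α} → zero < α → (∀ ξ → ξ < α → next ξ < α) → Limit κ α
  limit-of-next-closed 0<α closed =
    (_ , 0<α) , (λ ξ ξ<α → inj₁ ξ<α) ,
    λ β bound → ≮⇒≥ (λ β<α → ≤⇒≯ (bound (next β) (closed β β<α)) <-next)

  limit-next : ∀ {α} → Limit κ α → ∀ {ξ} → ξ < α → next ξ < α
  limit-next (_ , _ , sup) {ξ} ξ<α = by-contradiction λ ¬lt →
    ≤⇒≯ (sup ξ (λ η η<α → <-next⇒≤ (<-≤-trans η<α (≮⇒≥ ¬lt)))) ξ<α

  limit-zero : ∀ {α} → Limit κ α → zero < α
  limit-zero ((ξ , ξ<α) , _) = ≤-<-trans (zero-≤ ξ) ξ<α

  limit-fin : ∀ {α} → Limit κ α → ∀ n → fin n < α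
  limit-fin lim 0         = limit-zero lim
  limit-fin lim (ℕ.suc n) = limit-next lim (limit-fin lim n)

  limit-ω : ∀ {α} → Limit κ α → ω₀ ≤ α
  limit-ω lim = μ-≤ (λ β → ∀ n → fin n < β) (limit-fin lim)

  sup-cofinal : ∀ {D α} → IsSup κ D α → ∀ {ξ} → ξ < α → ∃[ δ ] (D δ × ξ < δ)
  sup-cofinal (_ , sup) {ξ} ξ<α = by-contradiction λ none →
    ≤⇒≯ (sup ξ (λ δ δ∈D → ≮⇒≥ (λ ξ<δ → none (δ , δ∈D , ξ<δ)))) ξ<α

  ClosurePoint : (Ord → Ord) → Ord → Pred Ord ℓ
  ClosurePoint c b γ = b < γ × (∀ ξ → ξ < γ → c ξ < γ)

  -- Closure points arise as least strict upper bounds of ω-sequences in which `x (suc n)` bounds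
  -- `c` on `↓ (x n)`. Regularity serves twice: for these bounds, and for a bound of the sequence
  -- itself, moved to the domain `ω₀` by `nat`.
  closurePoints-club : ∀ c b → ClubIn κ U (ClosurePoint c b)
  closurePoints-club c b = ((λ _ → _) , λ β _ → cofinal β) , closed
    where
    closed : ∀ β → _ → Satisfiable (↓ β) → IsSup κ (λ γ → ClosurePoint c b γ × γ < β) β → ClosurePoint c b β
    closed β _ (ξ₀ , ξ₀<β) sup =
      (let γ , ((b<γ , _) , γ<β) , _ = sup-cofinal sup ξ₀<β in <-trans b<γ γ<β) ,
      λ ξ ξ<β → let γ , ((_ , cl) , γ<β) , ξ<γ = sup-cofinal sup ξ<β in <-trans (cl ξ ξ<γ) γ<β
    module _ (β : Ord) where
      x : ℕ → Ord
      x 0         = b ⊔ₒ β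
      x (ℕ.suc n) = next (x n) ⊔ₒ proj₁ (regular (x n) c)
      x-step : ∀ n → x n < x (ℕ.suc n)
      x-step n = <-≤-trans <-next (≤-⊔ˡ _ _)
      x-bound : ∃[ λ′ ] (∀ n → x n < λ′)
      x-bound with regular ω₀ (x ∘ nat)
      ... | (λ′ , x<λ′) = λ′ , λ n → subst (λ m → x m < λ′) (nat-fin n) (x<λ′ (fin n) (fin<ω₀ n))
      lim : Ord
      lim = μ (λ λ′ → ∀ n → x n < λ′)
      x<lim : ∀ n → x n < lim
      x<lim = μ-∈ (λ λ′ → ∀ n → x n < λ′) x-bound
      lim-least : ∀ {ξ} → ξ < lim → ∃[ n ] (ξ ≤ x n)
      lim-least ξ<lim = by-contradiction λ none →
        ≤⇒≯ (μ-≤ (λ λ′ → ∀ n → x n < λ′) (λ n → ≰⇒> (λ ξ≤x → none (n , ξ≤x)))) ξ<lim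
      cofinal : ∃[ γ ] (ClosurePoint c b γ × β ≤ γ)
      cofinal = lim ,
        ( ≤-<-trans (≤-⊔ˡ b β) (x<lim 0)
        , λ ξ ξ<lim → let n , ξ≤x = lim-least ξ<lim in
            <-trans (<-≤-trans (proj₂ (regular (x (ℕ.suc n)) c) ξ (≤-<-trans ξ≤x (x-step n)))
                               (≤-⊔ʳ (next (x (ℕ.suc n))) _))
                    (x<lim (ℕ.suc (ℕ.suc n))))
        , inj₁ (≤-<-trans (≤-⊔ʳ b β) (x<lim 0))

-- Gödel's ordering of pairs, and pairing functions on infinite ordinals.

module Pairing
  (em : ∀ {a} → ExcludedMiddle a) {ℓ : Level} (κ : RegularUncountableCardinal ℓ) where

  open Ordinals em κ

  infix 4 _≺ₚ_
  _≺ₚ_ : Rel (Ord × Ord) ℓ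
  _≺ₚ_ = ×-Lex _≡_ _<_ (×-Lex _≡_ _<_ _<_) on (λ (ξ , η) → ξ ⊔ₒ η , ξ , η)

  ≺ₚ-wellFounded : WellFounded _≺ₚ_
  ≺ₚ-wellFounded =
    On.wellFounded _ (×-wellFounded <-wellFounded (×-wellFounded <-wellFounded <-wellFounded))

  ≺ₚ-connex : ∀ p q → p ≺ₚ q ⊎ p ≡ q ⊎ q ≺ₚ p
  ≺ₚ-connex (ξ , η) (ξ′ , η′) with compare (ξ ⊔ₒ η) (ξ′ ⊔ₒ η′) | compare ξ ξ′ | compare η η′
  ... | tri< m<m′ _ _ | _               | _               = inj₁ (inj₁ m<m′)
  ... | tri> _ _ m′<m | _               | _               = inj₂ (inj₂ (inj₁ m′<m))
  ... | tri≈ _ m≡m′ _ | tri< ξ<ξ′ _ _   | _               = inj₁ (inj₂ (m≡m′ , inj₁ ξ<ξ′))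
  ... | tri≈ _ m≡m′ _ | tri> _ _ ξ′<ξ   | _               = inj₂ (inj₂ (inj₂ (sym m≡m′ , inj₁ ξ′<ξ)))
  ... | tri≈ _ m≡m′ _ | tri≈ _ refl _   | tri< η<η′ _ _   = inj₁ (inj₂ (m≡m′ , inj₂ (refl , η<η′)))
  ... | tri≈ _ m≡m′ _ | tri≈ _ refl _   | tri> _ _ η′<η   = inj₂ (inj₂ (inj₂ (sym m≡m′ , inj₂ (refl , η′<η))))
  ... | tri≈ _ m≡m′ _ | tri≈ _ refl _   | tri≈ _ refl _   = inj₂ (inj₁ refl)

  ≺ₚ⇒⊔≤ : ∀ {ξ η ξ′ η′} → (ξ , η) ≺ₚ (ξ′ , η′) → ξ ⊔ₒ η ≤ ξ′ ⊔ₒ η′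
  ≺ₚ⇒⊔≤ (inj₁ m<m′)       = inj₁ m<m′
  ≺ₚ⇒⊔≤ (inj₂ (m≡m′ , _)) = inj₂ m≡m′

  open LeastChoice ≺ₚ-wellFounded using (choose; choose-∈; choose-≤)

  private
    Fresh : Ord × Ord → (Ord × Ord → Ord) → Ord → Set ℓ
    Fresh p g ξ = ∀ q → q ≺ₚ p → g q ≢ ξ

  -- The rank function of Gödel's well-ordering of pairs.
  gödel : Ord × Ord → Ord
  gödel = choose Fresh

  private
    -- The predecessors of `(a , b)` lie in a square of side `next (a ⊔ₒ b)`. Regularity bounds
    -- their ranks within each row and then bounds the row bounds.
    fresh : ∀ p → ∃[ ξ ] Fresh p gödel ξ
    fresh (a , b) = proj₁ bound , λ (c , d) q≺p eq → <⇒≢ (small c d (≺ₚ⇒⊔≤ q≺p)) eq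
      where
      row : Ord → Ord
      row c = proj₁ (regular (next (a ⊔ₒ b)) (λ d → gödel (c , d)))
      bound : ∃[ β ] (∀ c → c < next (a ⊔ₒ b) → row c < β)
      bound = regular (next (a ⊔ₒ b)) row
      small : ∀ c d → c ⊔ₒ d ≤ a ⊔ₒ b → gödel (c , d) < proj₁ bound
      small c d ≤m = <-trans
        (proj₂ (regular (next (a ⊔ₒ b)) (λ d → gödel (c , d))) d (≤⇒<-next (≤-trans (≤-⊔ʳ c d) ≤m)))
        (proj₂ bound c (≤⇒<-next (≤-trans (≤-⊔ˡ c d) ≤m)))

    gödel-≢ : ∀ {p q} → q ≺ₚ p → gödel q ≢ gödel p
    gödel-≢ {p} {q} q≺p with choose-∈ Fresh p (fresh p)
    ... | g , g≡ , isFresh = λ eq → isFresh q q≺p (trans (g≡ q q≺p) eq)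

  gödel-injective : ∀ {p q} → gödel p ≡ gödel q → p ≡ q
  gödel-injective {p} {q} eq with ≺ₚ-connex p q
  ... | inj₁ p≺q        = ⊥-elim (gödel-≢ p≺q eq)
  ... | inj₂ (inj₁ p≡q) = p≡q
  ... | inj₂ (inj₂ q≺p) = ⊥-elim (gödel-≢ q≺p (sym eq))

  ungödel : Ord → Ord × Ord
  ungödel ζ with em {P = ∃[ q ] (gödel q ≡ ζ)}
  ... | yes (q , _) = q
  ... | no _        = zero , zero

  -- The ranks form an initial segment: `gödel p` is the least value not taken before `p`, so a
  -- smaller `ζ` is taken before `p`.
  ungödel-≺ : ∀ {p ζ} → ζ < gödel p → ungödel ζ ≺ₚ p × gödel (ungödel ζ) ≡ ζ
  ungödel-≺ {p} {ζ} ζ<p with em {P = ∃[ q ] (gödel q ≡ ζ)}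
  ... | no none = ⊥-elim
    (≤⇒≯ (choose-≤ Fresh p (λ q _ eq → none (q , eq))) ζ<p)
  ... | yes (q , refl) = by-contradiction (λ q⊀p →
    ≤⇒≯ (choose-≤ Fresh p (λ r r≺p eq → q⊀p (subst (_≺ₚ p) (gödel-injective eq) r≺p))) ζ<p) , refl

  -- α · α ≤ α for infinite α

  record Embeds (α β : Ord) : Set ℓ where
    field
      to        : Ord → Ord
      to-<      : ∀ {ξ} → ξ < α → to ξ < β
      injective : ∀ {ξ η} → ξ < α → η < α → to ξ ≡ to η → ξ ≡ η

  record Square (α : Ord) : Set ℓ where
    field
      pair           : Ord → Ord → Ord
      pair-<         : ∀ {ξ η} → ξ < α → η < α → pair ξ η < α
      pair-injective : ∀ {ξ η ξ′ η′} → ξ < α → η < α → ξ′ < α → η′ < α →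
                       pair ξ η ≡ pair ξ′ η′ → ξ ≡ ξ′ × η ≡ η′

  private
    -- Pairs of sum `s` get values from `s * s` to `s * s + s`, all below `(s + 1) * (s + 1)`, so
    -- distinct diagonals do not overlap.
    ℕ-pair : ℕ → ℕ → ℕ
    ℕ-pair m n = (m ℕ.+ n) ℕ.* (m ℕ.+ n) ℕ.+ m

    ℕ-pair-mono : ∀ {m n m′ n′} → m ℕ.+ n ℕ.< m′ ℕ.+ n′ → ℕ-pair m n ℕ.< ℕ-pair m′ n′
    ℕ-pair-mono {m} {n} {m′} {n′} s<s′ = begin-strict
      s ℕ.* s ℕ.+ m          ≤⟨ ℕ.+-monoʳ-≤ (s ℕ.* s) (ℕ.m≤m+n m n) ⟩
      s ℕ.* s ℕ.+ s          ≡⟨ ℕ.+-comm (s ℕ.* s) s ⟩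
      s ℕ.+ s ℕ.* s          ≡⟨ ℕ.*-suc s s ⟨
      s ℕ.* ℕ.suc s          <⟨ ℕ.*-monoˡ-< (ℕ.suc s) (ℕ.n<1+n s) ⟩
      ℕ.suc s ℕ.* ℕ.suc s    ≤⟨ ℕ.*-mono-≤ s<s′ s<s′ ⟩
      s′ ℕ.* s′              ≤⟨ ℕ.m≤m+n (s′ ℕ.* s′) m′ ⟩
      s′ ℕ.* s′ ℕ.+ m′       ∎
      where
      open ℕ.≤-Reasoning
      s = m ℕ.+ n
      s′ = m′ ℕ.+ n′

    ℕ-pair-injective : ∀ m n m′ n′ → ℕ-pair m n ≡ ℕ-pair m′ n′ → m ≡ m′ × n ≡ n′
    ℕ-pair-injective m n m′ n′ eq with ℕ.<-cmp (m ℕ.+ n) (m′ ℕ.+ n′)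
    ... | tri< s<s′ _ _ = ⊥-elim (ℕ.<⇒≢ (ℕ-pair-mono {m} {n} {m′} {n′} s<s′) eq)
    ... | tri> _ _ s′<s = ⊥-elim (ℕ.<⇒≢ (ℕ-pair-mono {m′} {n′} {m} {n} s′<s) (sym eq))
    ... | tri≈ _ s≡s′ _ = m≡m′ ,
      ℕ.+-cancelˡ-≡ m n n′ (trans s≡s′ (cong (ℕ._+ n′) (sym m≡m′)))
      where
      m≡m′ : m ≡ m′
      m≡m′ = ℕ.+-cancelˡ-≡ ((m ℕ.+ n) ℕ.* (m ℕ.+ n)) m m′
        (trans eq (cong (λ s → s ℕ.* s ℕ.+ m′) (sym s≡s′)))

    square-ω : Square ω₀
    square-ω = record
      { pair           = λ ξ η → fin (ℕ-pair (nat ξ) (nat η))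
      ; pair-<         = λ {ξ} {η} _ _ → fin<ω₀ (ℕ-pair (nat ξ) (nat η))
      ; pair-injective = λ {ξ} {η} {ξ′} {η′} ξ<ω η<ω ξ′<ω η′<ω eq →
          let eq₁ , eq₂ = ℕ-pair-injective (nat ξ) (nat η) (nat ξ′) (nat η′) (fin-injective eq)
          in nat-injective ξ<ω ξ′<ω eq₁ , nat-injective η<ω η′<ω eq₂
      }
      where
      nat-injective : ∀ {ξ η} → ξ < ω₀ → η < ω₀ → nat ξ ≡ nat η → ξ ≡ η
      nat-injective ξ<ω η<ω eq =
        trans (sym (fin-nat (<ω₀⇒fin ξ<ω))) (trans (cong fin eq) (fin-nat (<ω₀⇒fin η<ω)))

    square-embeds : ∀ {α β} → β < α → Embeds α β → Square β → Square α
    square-embeds β<α e s = record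
      { pair           = λ ξ η → pair (to ξ) (to η)
      ; pair-<         = λ ξ<α η<α → <-trans (pair-< (to-< ξ<α) (to-< η<α)) β<α
      ; pair-injective = λ ξ<α η<α ξ′<α η′<α eq →
          let eq₁ , eq₂ = pair-injective (to-< ξ<α) (to-< η<α) (to-< ξ′<α) (to-< η′<α) eq
          in injective ξ<α ξ′<α eq₁ , injective η<α η′<α eq₂
      }
      where
      open Embeds e
      open Square s

    -- One more point fits into the square: the ordinals below `μ` use the pairs with second
    -- component 0, and `μ` itself takes the pair (0, 1).
    embeds-next : ∀ {μ} → ω₀ ≤ μ → Square μ → Embeds (next μ) μ
    embeds-next {μ} ω≤μ s = record
      { to        = λ ξ → shift ξ (<-≤-dec ξ μ)
      ; to-<      = λ {ξ} _ → shift-< ξ (<-≤-dec ξ μ)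
      ; injective = λ {ξ} {η} ξ≤μ η≤μ → shift-injective ξ η (<-≤-dec ξ μ) (<-≤-dec η μ) ξ≤μ η≤μ
      }
      where
      open Square s
      0<μ : fin 0 < μ
      0<μ = <-≤-trans (fin<ω₀ 0) ω≤μ
      1<μ : fin 1 < μ
      1<μ = <-≤-trans (fin<ω₀ 1) ω≤μ
      shift : ∀ ξ → ξ < μ ⊎ μ ≤ ξ → Ord
      shift ξ (inj₁ _) = pair ξ (fin 0)
      shift ξ (inj₂ _) = pair (fin 0) (fin 1)
      shift-< : ∀ ξ d → shift ξ d < μ
      shift-< ξ (inj₁ ξ<μ) = pair-< ξ<μ 0<μ
      shift-< ξ (inj₂ _)   = pair-< 0<μ 1<μ
      0≢1 : fin 0 ≢ fin 1
      0≢1 = <⇒≢ (fin-mono {0} {1} (ℕ.s≤s ℕ.z≤n))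
      shift-injective : ∀ ξ η d d′ → ξ < next μ → η < next μ → shift ξ d ≡ shift η d′ → ξ ≡ η
      shift-injective ξ η (inj₁ ξ<μ) (inj₁ η<μ) _ _ eq = proj₁ (pair-injective ξ<μ 0<μ η<μ 0<μ eq)
      shift-injective ξ η (inj₁ ξ<μ) (inj₂ _)   _ _ eq = ⊥-elim (0≢1 (proj₂ (pair-injective ξ<μ 0<μ 0<μ 1<μ eq)))
      shift-injective ξ η (inj₂ _)   (inj₁ η<μ) _ _ eq = ⊥-elim (0≢1 (proj₂ (pair-injective η<μ 0<μ 0<μ 1<μ (sym eq))))
      shift-injective ξ η (inj₂ μ≤ξ) (inj₂ μ≤η) ξ≤μ η≤μ _ =
        trans (≤-antisym (<-next⇒≤ ξ≤μ) μ≤ξ) (≤-antisym μ≤η (<-next⇒≤ η≤μ))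

    -- If ↓ α does not embed into a smaller infinite ordinal, then every proper
    -- initial segment of the Gödel ordering of ↓ α × ↓ α is too small to
    -- reach the rank α.
    square-initial : ∀ {α} → ω₀ < α → (∀ β → ω₀ ≤ β → β < α → ¬ Embeds α β) →
                     (∀ β → ω₀ ≤ β → β < α → Square β) → Square α
    square-initial {α} ω<α initial squares = record
      { pair           = λ ξ η → gödel (ξ , η)
      ; pair-<         = λ ξ<α η<α → ≰⇒> (too-small ξ<α η<α)
      ; pair-injective = λ _ _ _ _ eq → cong proj₁ (gödel-injective eq) , cong proj₂ (gödel-injective eq)
      }
      where
      too-small : ∀ {ξ η} → ξ < α → η < α → ¬ (α ≤ gödel (ξ , η))
      too-small {ξ} {η} ξ<α η<α α≤ = initial m ω≤m m<α (record
        { to        = code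
        ; to-<      = λ ζ<α → pair-< (shift.to-< (q₁< ζ<α)) (shift.to-< (q₂< ζ<α))
        ; injective = λ {ζ} {ζ′} ζ<α ζ′<α eq → code-injective ζ<α ζ′<α eq
        })
        where
        -- The join with `ω₀` makes `m` infinite, so that a pairing on it is at hand; components of
        -- predecessors are only `≤ m`, which is where `embeds-next` comes in.
        m : Ord
        m = ω₀ ⊔ₒ (ξ ⊔ₒ η)
        ω≤m : ω₀ ≤ m
        ω≤m = ≤-⊔ˡ ω₀ (ξ ⊔ₒ η)
        m<α : m < α
        m<α = ⊔-lub-< ω<α (⊔-lub-< ξ<α η<α)
        open Square (squares m ω≤m m<α)
        module shift = Embeds (embeds-next ω≤m (squares m ω≤m m<α))
        preds : ∀ {ζ} → ζ < α → ungödel ζ ≺ₚ (ξ , η) × gödel (ungödel ζ) ≡ ζ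
        preds ζ<α = ungödel-≺ (<-≤-trans ζ<α α≤)
        ⊔≤m : ∀ {ζ} → ζ < α → proj₁ (ungödel ζ) ⊔ₒ proj₂ (ungödel ζ) ≤ m
        ⊔≤m ζ<α = ≤-trans (≺ₚ⇒⊔≤ (proj₁ (preds ζ<α))) (≤-⊔ʳ ω₀ (ξ ⊔ₒ η))
        q₁< : ∀ {ζ} → ζ < α → proj₁ (ungödel ζ) < next m
        q₁< ζ<α = ≤⇒<-next (≤-trans (≤-⊔ˡ _ _) (⊔≤m ζ<α))
        q₂< : ∀ {ζ} → ζ < α → proj₂ (ungödel ζ) < next m
        q₂< ζ<α = ≤⇒<-next (≤-trans (≤-⊔ʳ _ _) (⊔≤m ζ<α))
        code : Ord → Ord
        code ζ = pair (shift.to (proj₁ (ungödel ζ))) (shift.to (proj₂ (ungödel ζ)))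
        code-injective : ∀ {ζ ζ′} → ζ < α → ζ′ < α → code ζ ≡ code ζ′ → ζ ≡ ζ′
        code-injective ζ<α ζ′<α eq =
          let eq₁ , eq₂ = pair-injective (shift.to-< (q₁< ζ<α)) (shift.to-< (q₂< ζ<α))
                                         (shift.to-< (q₁< ζ′<α)) (shift.to-< (q₂< ζ′<α)) eq
          in trans (sym (proj₂ (preds ζ<α))) (trans
               (cong gödel (cong₂ _,_ (shift.injective (q₁< ζ<α) (q₁< ζ′<α) eq₁)
                                      (shift.injective (q₂< ζ<α) (q₂< ζ′<α) eq₂)))
               (proj₂ (preds ζ′<α)))

  -- Either `α` embeds into a smaller infinite ordinal and inherits its pairing, or it is an initial
  -- ordinal and the Gödel ranks of its pairs stay below it.
  square : ∀ α → ω₀ ≤ α → Square α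
  square = <-induction (λ α → ω₀ ≤ α → Square α) step
    where
    step : ∀ α → (∀ β → β < α → ω₀ ≤ β → Square β) → ω₀ ≤ α → Square α
    step α ih (inj₂ refl) = square-ω
    step α ih (inj₁ ω<α) with em {P = ∃[ β ] (ω₀ ≤ β × β < α × Embeds α β)}
    ... | yes (β , ω≤β , β<α , e) = square-embeds β<α e (ih β β<α ω≤β)
    ... | no none = square-initial ω<α (λ β ω≤β β<α e → none (β , ω≤β , β<α , e))
                                       (λ β ω≤β β<α → ih β β<α ω≤β)

  -- The bound max{ω, α} of both slimness and prolificness; being infinite, it carries a pairing at
  -- every level.
  hat : Ord → Ord
  hat α = ω₀ ⊔ₒ α

  hat-mono : ∀ {α β} → α ≤ β → hat α ≤ hat β
  hat-mono α≤β = ⊔-lub (≤-⊔ˡ _ _) (≤-trans α≤β (≤-⊔ʳ _ _))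

  hat-of-infinite : ∀ {α} → ω₀ ≤ α → hat α ≡ α
  hat-of-infinite ω≤α = ≤-antisym (⊔-lub ω≤α ≤-refl) (≤-⊔ʳ _ _)

  fin<hat : ∀ n {α} → fin n < hat α
  fin<hat n = <-≤-trans (fin<ω₀ n) (≤-⊔ˡ _ _)

  module _ (α : Ord) where
    private module S = Square (square (hat α) (≤-⊔ˡ ω₀ α))

    pair : Ord → Ord → Ord
    pair = S.pair

    pair-< : ∀ {ξ η} → ξ < hat α → η < hat α → pair ξ η < hat α
    pair-< = S.pair-<

    -- The inverse of pair, with both components below hat α in every case.
    unpair : Ord → Ord × Ord
    unpair i with em {P = ∃[ ξ ] ∃[ η ] (ξ < hat α × η < hat α × pair ξ η ≡ i)}
    ... | yes (ξ , η , _) = ξ , η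
    ... | no _            = zero , zero

    unpair-< : ∀ i → proj₁ (unpair i) < hat α × proj₂ (unpair i) < hat α
    unpair-< i with em {P = ∃[ ξ ] ∃[ η ] (ξ < hat α × η < hat α × pair ξ η ≡ i)}
    ... | yes (ξ , η , ξ< , η< , _) = ξ< , η<
    ... | no _                      = fin<hat 0 , fin<hat 0

    unpair-pair : ∀ {ξ η} → ξ < hat α → η < hat α → unpair (pair ξ η) ≡ (ξ , η)
    unpair-pair {ξ} {η} ξ< η<
      with em {P = ∃[ ξ′ ] ∃[ η′ ] (ξ′ < hat α × η′ < hat α × pair ξ′ η′ ≡ pair ξ η)}
    ... | no none = ⊥-elim (none (ξ , η , ξ< , η< , refl))
    ... | yes (ξ′ , η′ , ξ′< , η′< , eq) =
      let eq₁ , eq₂ = S.pair-injective ξ′< η′< ξ< η< eq in cong₂ _,_ eq₁ eq₂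

-- Canonical branches and the levels made from them.

module Construction
  (em : ∀ {a} → ExcludedMiddle a) {ℓ : Level} (κ : RegularUncountableCardinal ℓ)
  (C : RegularUncountableCardinal.Ord κ → Pred (RegularUncountableCardinal.Ord κ) ℓ)
  (club : ∀ α → Limit κ α → ClubIn κ (RegularUncountableCardinal.↓ κ α) (C α))
  (coherent : ∀ α ᾱ → ᾱ ∈ Defs.acc κ (C α) → _⊑_ κ (C ᾱ) (C α))
  (Z : RegularUncountableCardinal.Ord κ → Pred (RegularUncountableCardinal.Ord κ) ℓ)
  where

  open Ordinals em κ
  open Pairing em κ
  open LeastChoice <-wellFounded

  infix 4 _≈[_]_
  _≈[_]_ : (Ord → Ord) → Ord → (Ord → Ord) → Set ℓ
  s ≈[ β ] t = ∀ ξ → ξ < β → s ξ ≡ t ξ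

  ≈-sym : ∀ {s t β} → s ≈[ β ] t → t ≈[ β ] s
  ≈-sym s≈t ξ ξ<β = sym (s≈t ξ ξ<β)

  ≈-trans : ∀ {s t u β} → s ≈[ β ] t → t ≈[ β ] u → s ≈[ β ] u
  ≈-trans s≈t t≈u ξ ξ<β = trans (s≈t ξ ξ<β) (t≈u ξ ξ<β)

  ≈-restrict : ∀ {s t β γ} → β ≤ γ → s ≈[ γ ] t → s ≈[ β ] t
  ≈-restrict β≤γ s≈t ξ ξ<β = s≈t ξ (<-≤-trans ξ<β β≤γ)

  -- Level α of the tree consists of the restrictions to α of p α (inj₁ i), and
  -- p α (inj₂ n) is the n-th entry of the ascent path at α.
  Family : Set ℓ
  Family = Ord → Ord ⊎ ℕ → Ord → Ord

  -- inj₁ (β , x) stands for the canonical branch through node x of level β,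
  -- inj₂ n for the n-th entry of the ascent path.
  Tag : Set ℓ
  Tag = (Ord × Ord) ⊎ ℕ

  startLevel startIndex : Tag → Ord
  startLevel (inj₁ (β , _)) = β
  startLevel (inj₂ _)       = zero
  startIndex (inj₁ (_ , x)) = x
  startIndex (inj₂ _)       = zero

  IsPred : Pred Ord ℓ → Ord → Ord → Set ℓ
  IsPred D δ γ = D δ × δ < γ × (∀ ξ → D ξ → ξ < γ → ξ ≤ δ)

  -- If γ is the k-th successor in D of min D or of an accumulation point of D,
  -- then Late D n γ holds iff n ≤ k.
  Late : Pred Ord ℓ → ℕ → Ord → Set ℓ
  Late D 0         γ = Poly.⊤
  Late D (ℕ.suc n) γ = ∃[ δ ] (IsPred D δ γ × Late D n δ)

  Extends : Family → Pred Ord ℓ → Tag → Ord → (Ord → Ord) → Pred Ord ℓ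
  Extends p D τ γ g i =
    startLevel τ < γ ×
    p (startLevel τ) (inj₁ (startIndex τ)) ≈[ startLevel τ ] p γ (inj₁ i) ×
    (∀ δ → D δ → startLevel τ < δ → δ < γ → p δ (inj₁ (g δ)) ≈[ δ ] p γ (inj₁ i))

  -- The negated clause holds at a fixed `γ` for almost all `n`, which serves the ascent path; for a
  -- fixed `n` it fails far enough into each block, which serves sealing.
  Preferred : Family → Pred Ord ℓ → Tag → Ord → Pred Ord ℓ
  Preferred p D (inj₁ _) γ i = Poly.⊥
  Preferred p D (inj₂ n) γ i = p γ (inj₁ i) ≈[ γ ] p γ (inj₂ n) × ¬ Late D (ℕ.suc n) γ

  Sealed : Family → Ord → Pred Ord ℓ
  Sealed p γ i = ∃[ δ ] ∃[ j ] (δ < γ × Z γ (gödel (δ , j)) × p δ (inj₁ j) ≈[ δ ] p γ (inj₁ i))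

  infixr 5 _▹_
  _▹_ : ∀ {p q} → Pred Ord p → Pred Ord q → Pred Ord (p ⊔ q ⊔ ℓ)
  (P ▹ Q) i = P i ⊎ ¬ Satisfiable P × Q i

  -- `P` also occurs negatively, so mere inclusion would not do for it.
  ▹-mono : ∀ {p q r s} {P : Pred Ord p} {P′ : Pred Ord q} {Q : Pred Ord r} {Q′ : Pred Ord s} →
           P ≐ P′ → Q ⊆ Q′ → P ▹ Q ⊆ P′ ▹ Q′
  ▹-mono (P⊆P′ , _)    Q⊆Q′ (inj₁ p)        = inj₁ (P⊆P′ p)
  ▹-mono (_    , P′⊆P) Q⊆Q′ (inj₂ (¬P , q)) = inj₂ ((λ (i , p′) → ¬P (i , P′⊆P p′)) , Q⊆Q′ q)

  ▹-satisfiable : ∀ {p q} {P : Pred Ord p} {Q : Pred Ord q} → Satisfiable Q → Satisfiable (P ▹ Q)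
  ▹-satisfiable {P = P} (i , q) with em {P = Satisfiable P}
  ... | yes (j , p) = j , inj₁ p
  ... | no ¬P       = i , inj₂ (¬P , q)

  ▹-case : ∀ {p q r} {P : Pred Ord p} {Q : Pred Ord q} {R : Set r} {i} →
           (P i → R) → (Q i → R) → (P ▹ Q) i → R
  ▹-case P⇒R Q⇒R (inj₁ p)       = P⇒R p
  ▹-case P⇒R Q⇒R (inj₂ (_ , q)) = Q⇒R q

  ▹-first : ∀ {p q} {P : Pred Ord p} {Q : Pred Ord q} {i} → Satisfiable P → (P ▹ Q) i → P i
  ▹-first sat (inj₁ p)        = p
  ▹-first sat (inj₂ (¬P , _)) = ⊥-elim (¬P sat)

  ▹-second : ∀ {p q} {P : Pred Ord p} {Q : Pred Ord q} {i} → ¬ Satisfiable P → (P ▹ Q) i → Q i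
  ▹-second ¬P (inj₁ p)       = ⊥-elim (¬P (_ , p))
  ▹-second ¬P (inj₂ (_ , q)) = q

  module _ (p : Family) (D : Pred Ord ℓ) (τ : Tag) (γ : Ord) (g : Ord → Ord) where

    PreferredExtension SealedExtension Rule : Pred Ord ℓ
    PreferredExtension = Preferred p D τ γ ∩ Extends p D τ γ g
    SealedExtension    = Sealed p γ ∩ Extends p D τ γ g
    Rule               = PreferredExtension ▹ SealedExtension ▹ Extends p D τ γ g

  path : Family → Pred Ord ℓ → Tag → Ord → Ord
  path p D τ = choose (Rule p D τ)

  -- The value is read off the first chosen node that reaches above `ξ`. That every later chosen
  -- node gives the same value is proved separately and recorded in `Along`.
  branch : Family → Pred Ord ℓ → Tag → Ord → Ord
  branch p D τ ξ = p γ (inj₁ (path p D τ γ)) ξ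
    where
    γ : Ord
    γ = μ (λ γ → D γ × startLevel τ < γ × ξ < γ)

  -- Dependence on initial segments

  -- Used with one set and two families to see that the recursion on levels is well defined, and
  -- with one family and the sets `C α` and `C γ` to exploit coherence.
  record Agree (α : Ord) (p : Family) (D : Pred Ord ℓ) (q : Family) (E : Pred Ord ℓ) : Set ℓ where
    constructor agree
    field
      values : ∀ β → β < α → ∀ i ξ → p β i ξ ≡ q β i ξ
      sub    : ∀ δ → δ < α → D δ → E δ
      sup    : ∀ δ → δ < α → E δ → D δ

  Agree-sym : ∀ {α p D q E} → Agree α p D q E → Agree α q E p D
  Agree-sym (agree values sub sup) = agree (λ β β<α i ξ → sym (values β β<α i ξ)) sup sub

  module _ {α : Ord} {p : Family} {D : Pred Ord ℓ} {q : Family} {E : Pred Ord ℓ}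
           (a : Agree α p D q E) where
    open Agree a

    private
      transport : ∀ {δ γ i j} → δ < α → γ < α → p δ i ≈[ δ ] p γ j → q δ i ≈[ δ ] q γ j
      transport δ<α γ<α s≈t ξ ξ<δ =
        trans (sym (values _ δ<α _ ξ)) (trans (s≈t ξ ξ<δ) (values _ γ<α _ ξ))

    Extends-resp : ∀ τ {γ g h} → γ < α → AgreeBelow γ g h →
                   Extends p D τ γ g ⊆ Extends q E τ γ h
    Extends-resp τ {γ} {g} {h} γ<α g≡h (start< , start , earlier) =
      start< , transport (<-trans start< γ<α) γ<α start ,
      λ δ δ∈E start<δ δ<γ →
        subst (λ j → q δ (inj₁ j) ≈[ δ ] q γ _) (g≡h δ δ<γ)
          (transport (<-trans δ<γ γ<α) γ<α
            (earlier δ (sup δ (<-trans δ<γ γ<α) δ∈E) start<δ δ<γ))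

    Late-resp : ∀ n {γ} → γ < α → Late D n γ → Late E n γ
    Late-resp 0         γ<α _ = _
    Late-resp (ℕ.suc n) γ<α (δ , (δ∈D , δ<γ , δ-max) , late) =
      δ , (sub δ (<-trans δ<γ γ<α) δ∈D , δ<γ ,
           λ ξ ξ∈E ξ<γ → δ-max ξ (sup ξ (<-trans ξ<γ γ<α) ξ∈E) ξ<γ) ,
      Late-resp n (<-trans δ<γ γ<α) late

    Sealed-resp : ∀ {γ} → γ < α → Sealed p γ ⊆ Sealed q γ
    Sealed-resp γ<α (δ , j , δ<γ , z , s≈t) = δ , j , δ<γ , z , transport (<-trans δ<γ γ<α) γ<α s≈t

  Preferred-resp : ∀ {α p D q E} → Agree α p D q E → ∀ τ {γ} → γ < α →
                   Preferred p D τ γ ⊆ Preferred q E τ γ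
  Preferred-resp a (inj₁ _) γ<α ()
  Preferred-resp a (inj₂ n) {γ} γ<α (s≈t , ¬late) =
    (λ ξ ξ<γ → trans (sym (Agree.values a γ γ<α _ ξ)) (trans (s≈t ξ ξ<γ) (Agree.values a γ γ<α _ ξ))) ,
    λ late → ¬late (Late-resp (Agree-sym a) (ℕ.suc n) γ<α late)

  Rule-resp : ∀ {α p D q E} → Agree α p D q E → ∀ τ {γ g h} → γ < α → AgreeBelow γ g h →
              Rule p D τ γ g ⊆ Rule q E τ γ h
  Rule-resp {p = p} {D} {q} {E} a τ {γ} {g} {h} γ<α g≡h =
    ▹-mono {P = PreferredExtension p D τ γ g} {PreferredExtension q E τ γ h}
           {SealedExtension p D τ γ g ▹ Extends p D τ γ g} {SealedExtension q E τ γ h ▹ Extends q E τ γ h}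
           ( (λ (x , y) → Preferred-resp a τ γ<α x , Extends-resp a τ γ<α g≡h y)
           , (λ (x , y) → Preferred-resp a′ τ γ<α x , Extends-resp a′ τ γ<α h≡g y))
    (▹-mono {P = SealedExtension p D τ γ g} {SealedExtension q E τ γ h}
            {Extends p D τ γ g} {Extends q E τ γ h}
            ( (λ (x , y) → Sealed-resp a γ<α x , Extends-resp a τ γ<α g≡h y)
            , (λ (x , y) → Sealed-resp a′ γ<α x , Extends-resp a′ τ γ<α h≡g y))
     (Extends-resp a τ γ<α g≡h))
    where
    a′  = Agree-sym a
    h≡g = λ δ δ<γ → sym (g≡h δ δ<γ)

  path-cong : ∀ {α p D q E} → Agree α p D q E → ∀ τ γ → γ < α → path p D τ γ ≡ path q E τ γ
  path-cong {α} a τ = choose-cong (_< α) (λ δ<γ γ<α → <-trans δ<γ γ<α)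
    (λ γ γ<α g → Rule-resp a τ γ<α (λ _ _ → refl) , Rule-resp (Agree-sym a) τ γ<α (λ _ _ → refl))

  branch-cong : ∀ {α p q D} → D ⊆ ↓ α → zero < α →
                (∀ β → β < α → ∀ i ξ → p β i ξ ≡ q β i ξ) →
                ∀ τ ξ → branch p D τ ξ ≡ branch q D τ ξ
  branch-cong {α} {p} {q} {D} D⊆α 0<α p≡q τ ξ =
    trans (p≡q γ γ<α (inj₁ (path p D τ γ)) ξ)
      (cong (λ i → q γ (inj₁ i) ξ) (path-cong (agree p≡q (λ _ _ x → x) (λ _ _ x → x)) τ γ γ<α))
    where
    γ : Ord
    γ = μ (λ γ → D γ × startLevel τ < γ × ξ < γ)
    γ<α : γ < α
    -- If no element of `D` qualifies, the minimum defaults to `zero`, which is still below `α`.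
    γ<α with μ-∈-or-zero (λ γ → D γ × startLevel τ < γ × ξ < γ)
    ... | inj₁ (γ∈D , _) = D⊆α γ∈D
    ... | inj₂ γ≡0       = subst (_< α) (sym γ≡0) 0<α

  module _ (p : Family) (D : Pred Ord ℓ) (τ : Tag) {γ : Ord}
           (extendible : Satisfiable (Extends p D τ γ (path p D τ))) where

    path-rule : Rule p D τ γ (path p D τ) (path p D τ γ)
    path-rule = let g , g≡ , rule = choose-∈ (Rule p D τ) γ (▹-satisfiable (▹-satisfiable extendible)) in
      Rule-resp (agree (λ _ _ _ _ → refl) (λ _ _ x → x) (λ _ _ x → x)) τ <-next g≡ rule

    path-extends : Extends p D τ γ (path p D τ) (path p D τ γ)
    path-extends = ▹-case {P = PreferredExtension p D τ γ (path p D τ)}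
      {SealedExtension p D τ γ (path p D τ) ▹ Extends p D τ γ (path p D τ)} proj₂
      (▹-case {P = SealedExtension p D τ γ (path p D τ)} {Extends p D τ γ (path p D τ)} proj₂ (λ ext → ext))
      path-rule

    path-preferred : Satisfiable (PreferredExtension p D τ γ (path p D τ)) →
                     Preferred p D τ γ (path p D τ γ)
    path-preferred sat = proj₁ (▹-first {P = PreferredExtension p D τ γ (path p D τ)}
      {SealedExtension p D τ γ (path p D τ) ▹ Extends p D τ γ (path p D τ)} sat path-rule)

    path-sealed : ¬ Satisfiable (Preferred p D τ γ) →
                  Satisfiable (SealedExtension p D τ γ (path p D τ)) →
                  Sealed p γ (path p D τ γ)
    path-sealed ¬pref sat = proj₁ (▹-first {P = SealedExtension p D τ γ (path p D τ)} {Extends p D τ γ (path p D τ)} sat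
      (▹-second {P = PreferredExtension p D τ γ (path p D τ)}
        {SealedExtension p D τ γ (path p D τ) ▹ Extends p D τ γ (path p D τ)} (λ (i , pref , _) → ¬pref (i , pref))
        path-rule))

  -- The recursion on the levels

  data Shape (α : Ord) : Set ℓ where
    isZero  : α ≡ zero → Shape α
    isNext  : ∀ β → α ≡ next β → Shape α
    isLimit : Limit κ α → Shape α

  shape : ∀ α → Shape α
  shape α with zero-≤ α | em {P = ∃[ β ] (α ≡ next β)}
  ... | inj₂ 0≡α | _               = isZero (sym 0≡α)
  ... | inj₁ _   | yes (β , α≡β+1) = isNext β α≡β+1
  ... | inj₁ 0<α | no not-next     = isLimit (limit-of-next-closed 0<α next<)
    where
    next< : ∀ ξ → ξ < α → next ξ < α
    next< ξ ξ<α with next-≤ ξ<α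
    ... | inj₁ lt = lt
    ... | inj₂ eq = ⊥-elim (not-next (ξ , sym eq))

  next≢zero : ∀ {β} → next β ≢ zero
  next≢zero eq = ≮zero (subst (_ <_) eq <-next)

  next-not-limit : ∀ {β} → ¬ Limit κ (next β)
  next-not-limit lim = <-irrefl (limit-next lim <-next)

  snoc : Ord → (Ord → Ord) → Ord → Ord → Ord
  snoc β t k ξ with <-≤-dec ξ β
  ... | inj₁ _ = t ξ
  ... | inj₂ _ = k

  snoc-≈ : ∀ {β t k} → snoc β t k ≈[ β ] t
  snoc-≈ {β} ξ ξ<β with <-≤-dec ξ β
  ... | inj₁ _   = refl
  ... | inj₂ β≤ξ = ⊥-elim (≤⇒≯ β≤ξ ξ<β)

  snoc-last : ∀ {β t k} → snoc β t k β ≡ k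
  snoc-last {β} with <-≤-dec β β
  ... | inj₁ β<β = ⊥-elim (<-irrefl β<β)
  ... | inj₂ _   = refl

  snoc-cong : ∀ {β s t k} → s ≈[ β ] t → snoc β s k ≈[ next β ] snoc β t k
  snoc-cong {β} s≈t ξ _ with <-≤-dec ξ β
  ... | inj₁ ξ<β = s≈t ξ ξ<β
  ... | inj₂ _   = refl

  clip : Ord → Ord → Ord
  clip β x with <-≤-dec x (hat β)
  ... | inj₁ _ = x
  ... | inj₂ _ = zero

  clip-< : ∀ β x → clip β x < hat β
  clip-< β x with <-≤-dec x (hat β)
  ... | inj₁ x< = x<
  ... | inj₂ _  = fin<hat 0

  clip-id : ∀ {β x} → x < hat β → clip β x ≡ x
  clip-id {β} {x} x<β with <-≤-dec x (hat β)
  ... | inj₁ _  = refl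
  ... | inj₂ ≥β = ⊥-elim (≤⇒≯ ≥β x<β)

  -- The tags used at a limit level α; the root needs no branch of its own, so
  -- the pairs (zero , n) code the entries of the ascent path.
  untag : Ord × Ord → Tag
  untag (β , x) with em {P = β ≡ zero}
  ... | yes _ = inj₂ (nat x)
  ... | no _  = inj₁ (β , clip β x)

  decode : Ord → Ord → Tag
  decode α i = untag (unpair α i)

  levelOf : ∀ {α} → Shape α → Family → Ord ⊎ ℕ → Ord → Ord
  levelOf     (isZero _)   p _        = λ _ → zero
  levelOf     (isNext β _) p (inj₁ i) = snoc β (p β (inj₁ (proj₁ (unpair β i)))) (proj₂ (unpair β i))
  -- Appending `fin n` makes the entries distinct already at level `next zero`.
  levelOf     (isNext β _) p (inj₂ n) = snoc β (p β (inj₂ n)) (fin n)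
  levelOf {α} (isLimit _)  p (inj₁ i) = branch p (C α) (decode α i)
  levelOf {α} (isLimit _)  p (inj₂ n) = branch p (C α) (inj₂ n)

  levelOf-cong : ∀ {α} (s : Shape α) {p q} → (∀ β → β < α → ∀ i ξ → p β i ξ ≡ q β i ξ) →
                 ∀ i ξ → levelOf s p i ξ ≡ levelOf s q i ξ
  levelOf-cong (isZero _)      p≡q _        ξ = refl
  levelOf-cong (isNext β refl) p≡q (inj₁ i) ξ with <-≤-dec ξ β
  ... | inj₁ _ = p≡q β <-next _ ξ
  ... | inj₂ _ = refl
  levelOf-cong (isNext β refl) p≡q (inj₂ n) ξ with <-≤-dec ξ β
  ... | inj₁ _ = p≡q β <-next _ ξ
  ... | inj₂ _ = refl
  levelOf-cong {α} (isLimit lim) p≡q (inj₁ i) =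
    branch-cong (proj₁ (proj₁ (club α lim))) (limit-zero lim) p≡q (decode α i)
  levelOf-cong {α} (isLimit lim) p≡q (inj₂ n) =
    branch-cong (proj₁ (proj₁ (club α lim))) (limit-zero lim) p≡q (inj₂ n)

  private
    extend : ∀ {α} → (∀ {β} → β < α → Ord ⊎ ℕ → Ord → Ord) → Family
    extend {α} ih β with <-≤-dec β α
    ... | inj₁ β<α = ih β<α
    ... | inj₂ _   = λ _ _ → zero

    extend-cong : ∀ {α} {ih ih′ : ∀ {β} → β < α → Ord ⊎ ℕ → Ord → Ord} →
                  (∀ {β} (β<α : β < α) i ξ → ih β<α i ξ ≡ ih′ β<α i ξ) →
                  ∀ β → β < α → ∀ i ξ → extend ih β i ξ ≡ extend ih′ β i ξ
    extend-cong {α} ih≡ih′ β _ i ξ with <-≤-dec β α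
    ... | inj₁ β<α = ih≡ih′ β<α i ξ
    ... | inj₂ _   = refl

    extend-≡ : ∀ {α} {q : Family} β → β < α → ∀ i ξ → extend {α} (λ {β} _ → q β) β i ξ ≡ q β i ξ
    extend-≡ {α} β β<α i ξ with <-≤-dec β α
    ... | inj₁ _   = refl
    ... | inj₂ α≤β = ⊥-elim (≤⇒≯ α≤β β<α)

    levels′ : ∀ α → Acc _<_ α → Ord ⊎ ℕ → Ord → Ord
    levels′ α (acc rs) = levelOf (shape α) (extend (λ {β} β<α → levels′ β (rs β<α)))

    levels′-irrelevant : ∀ α (r r′ : Acc _<_ α) i ξ → levels′ α r i ξ ≡ levels′ α r′ i ξ
    levels′-irrelevant α (acc rs) (acc rs′) = levelOf-cong (shape α)
      (extend-cong (λ {β} β<α → levels′-irrelevant β (rs β<α) (rs′ β<α)))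

  abstract
    levels : Family
    levels α = levels′ α (<-wellFounded α)

    levels-unfold : ∀ α i ξ → levels α i ξ ≡ levelOf (shape α) levels i ξ
    levels-unfold α i ξ with <-wellFounded α
    ... | acc rs = levelOf-cong (shape α) (λ β β<α i ξ → trans
            (extend-cong (λ {γ} γ<α → levels′-irrelevant γ (rs γ<α) (<-wellFounded γ)) β β<α i ξ)
            (extend-≡ β β<α i ξ)) i ξ

  e : Ord → Ord → Ord → Ord
  e α i = levels α (inj₁ i)

  f : Ord → ℕ → Ord → Ord
  f α n = levels α (inj₂ n)

  private
    levelOf-next : ∀ {β} (s : Shape (next β)) i →
                   levelOf s levels i ≡ levelOf (isNext β refl) levels i
    levelOf-next (isZero eq)   i = ⊥-elim (next≢zero eq)
    levelOf-next (isNext γ eq) i with next-injective eq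
    levelOf-next (isNext γ eq) (inj₁ i) | refl = refl
    levelOf-next (isNext γ eq) (inj₂ n) | refl = refl
    levelOf-next (isLimit lim) i = ⊥-elim (next-not-limit lim)

    levelOf-limit : ∀ {α} (lim : Limit κ α) (s : Shape α) i →
                    levelOf s levels i ≡ levelOf (isLimit lim) levels i
    levelOf-limit lim (isZero refl)   i        = ⊥-elim (<-irrefl (limit-zero lim))
    levelOf-limit lim (isNext _ refl) i        = ⊥-elim (next-not-limit lim)
    levelOf-limit lim (isLimit _)     (inj₁ i) = refl
    levelOf-limit lim (isLimit _)     (inj₂ n) = refl

  e-next : ∀ β i ξ → e (next β) i ξ ≡ snoc β (e β (proj₁ (unpair β i))) (proj₂ (unpair β i)) ξ
  e-next β i ξ = trans (levels-unfold (next β) (inj₁ i) ξ)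
    (cong (λ t → t ξ) (levelOf-next (shape (next β)) (inj₁ i)))

  f-next : ∀ β n ξ → f (next β) n ξ ≡ snoc β (f β n) (fin n) ξ
  f-next β n ξ = trans (levels-unfold (next β) (inj₂ n) ξ)
    (cong (λ t → t ξ) (levelOf-next (shape (next β)) (inj₂ n)))

  e-limit : ∀ {α} → Limit κ α → ∀ i ξ → e α i ξ ≡ branch levels (C α) (decode α i) ξ
  e-limit {α} lim i ξ = trans (levels-unfold α (inj₁ i) ξ)
    (cong (λ t → t ξ) (levelOf-limit lim (shape α) (inj₁ i)))

  f-limit : ∀ {α} → Limit κ α → ∀ n ξ → f α n ξ ≡ branch levels (C α) (inj₂ n) ξ
  f-limit {α} lim n ξ = trans (levels-unfold α (inj₂ n) ξ)
    (cong (λ t → t ξ) (levelOf-limit lim (shape α) (inj₂ n)))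

  -- Indices

  -- At nonzero levels an index is used only through `unpair`, whose components always lie below the
  -- hat; pairing them again gives a small index for the same node. Slimness rests on this.
  small-index : ∀ α i → ∃[ i′ ] (i′ < hat α × e α i ≈[ α ] e α i′)
  small-index α i with shape α
  ... | isZero refl = zero , fin<hat 0 , λ ξ ξ<0 → ⊥-elim (≮zero ξ<0)
  ... | isNext β refl =
    pair β j k , <-≤-trans (pair-< β j< k<) (hat-mono (inj₁ <-next)) , λ ξ _ →
      trans (e-next β i ξ) (trans
        (cong (λ (j , k) → snoc β (e β j) k ξ) (sym (unpair-pair β j< k<)))
        (sym (e-next β (pair β j k) ξ)))
    where
    j  = proj₁ (unpair β i)
    k  = proj₂ (unpair β i)
    j< = proj₁ (unpair-< β i)
    k< = proj₂ (unpair-< β i)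
  ... | isLimit lim =
    pair α j k , pair-< α j< k< , λ ξ _ →
      trans (e-limit lim i ξ) (trans
        (cong (λ u → branch levels (C α) (untag u) ξ) (sym (unpair-pair α j< k<)))
        (sym (e-limit lim (pair α j k) ξ)))
    where
    j  = proj₁ (unpair α i)
    k  = proj₂ (unpair α i)
    j< = proj₁ (unpair-< α i)
    k< = proj₂ (unpair-< α i)

  child : ∀ β j {k} → k < hat β → ∃[ i ] (e (next β) i ≈[ next β ] snoc β (e β j) k)
  child β j {k} k< =
    let j′ , j′< , j≈j′ = small-index β j in
    pair β j′ k , λ ξ ξ< → trans (e-next β (pair β j′ k) ξ) (trans
      (cong (λ (j , k) → snoc β (e β j) k ξ) (unpair-pair β j′< k<))
      (snoc-cong (≈-sym j≈j′) ξ ξ<))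

  -- `x < hat β` makes the tag codable at every limit above `β`, in particular at accumulation
  -- points met on the way. Level zero is excluded because pairs starting with `zero` code the
  -- ascent path.
  Valid : Pred Tag ℓ
  Valid (inj₁ (β , x)) = zero < β × x < hat β
  Valid (inj₂ n)       = Poly.⊤

  untag-valid : ∀ β x → Valid (untag (β , x))
  untag-valid β x with em {P = β ≡ zero}
  ... | yes _ = _
  ... | no β≢0 with zero-≤ β
  ... | inj₁ 0<β = 0<β , clip-< β x
  ... | inj₂ 0≡β = ⊥-elim (β≢0 (sym 0≡β))

  untag-startLevel : ∀ β x {α} → β < α → startLevel (untag (β , x)) < α
  untag-startLevel β x β<α with em {P = β ≡ zero}
  ... | yes refl = β<α
  ... | no _     = β<α

  decode-valid : ∀ α i → Valid (decode α i)
  decode-valid α i = untag-valid (proj₁ (unpair α i)) (proj₂ (unpair α i))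

  decode-startLevel : ∀ {α} → Limit κ α → ∀ i → startLevel (decode α i) < α
  decode-startLevel {α} lim i = untag-startLevel (proj₁ (unpair α i)) (proj₂ (unpair α i))
    (subst (proj₁ (unpair α i) <_) (hat-of-infinite (limit-ω lim)) (proj₁ (unpair-< α i)))

  encode : ∀ {α} τ → Valid τ → startLevel τ < α → ∃[ i ] (decode α i ≡ τ)
  encode {α} (inj₂ n) _ _ = pair α zero (fin n) ,
    trans (cong untag (unpair-pair α (fin<hat 0) (fin<hat n))) (untag-zero n)
    where
    untag-zero : ∀ n → untag (zero , fin n) ≡ inj₂ n
    untag-zero n with em {P = zero ≡ zero}
    ... | yes _  = cong inj₂ (nat-fin n)
    ... | no 0≢0 = ⊥-elim (0≢0 refl)
  encode {α} (inj₁ (β , x)) (0<β , x<) β<α = pair α β x ,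
    trans (cong untag (unpair-pair α (<-≤-trans β<α (≤-⊔ʳ _ _)) (<-≤-trans x< (hat-mono (inj₁ β<α)))))
          untag-pos
    where
    untag-pos : untag (β , x) ≡ inj₁ (β , x)
    untag-pos with em {P = β ≡ zero}
    ... | yes refl = ⊥-elim (<-irrefl 0<β)
    ... | no _     = cong (λ x → inj₁ (β , x)) (clip-id x<)

  limit-branch : ∀ {α} → Limit κ α → ∀ τ → Valid τ → startLevel τ < α →
                 ∃[ i ] (e α i ≈[ α ] branch levels (C α) τ)
  limit-branch {α} lim τ valid start< =
    let i , eq = encode τ valid start< in
    i , λ ξ _ → trans (e-limit lim i ξ) (cong (λ τ → branch levels (C α) τ ξ) eq)

  -- The clubs C α

  IsPred-unique : ∀ {D δ δ′ γ} → IsPred D δ γ → IsPred D δ′ γ → δ ≡ δ′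
  IsPred-unique (δ∈D , δ<γ , δ-max) (δ′∈D , δ′<γ , δ′-max) =
    ≤-antisym (δ′-max _ δ∈D δ<γ) (δ-max _ δ′∈D δ′<γ)

  -- Passing to the predecessor descends, so it can be repeated only finitely often.
  eventually-not-late : ∀ D γ → ∃[ N ] (∀ n → N ℕ.≤ n → ¬ Late D n γ)
  eventually-not-late D = <-induction _ step
    where
    step : ∀ γ → (∀ δ → δ < γ → ∃[ N ] (∀ n → N ℕ.≤ n → ¬ Late D n δ)) →
           ∃[ N ] (∀ n → N ℕ.≤ n → ¬ Late D n γ)
    step γ ih with em {P = ∃[ δ ] IsPred D δ γ}
    ... | no none = 1 , λ { (ℕ.suc n) _ (δ , pred , _) → none (δ , pred) }
    ... | yes (δ , pred@(_ , δ<γ , _)) with ih δ δ<γ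
    ... | N , ¬late = ℕ.suc N , λ { (ℕ.suc n) (ℕ.s≤s N≤n) (δ′ , pred′ , late) →
      ¬late n N≤n (subst (Late D n) (IsPred-unique pred′ pred) late) }

  module LimitLevel {α : Ord} (lim : Limit κ α) where

    C⊆α : C α ⊆ ↓ α
    C⊆α = proj₁ (proj₁ (club α lim))

    C-above : ∀ {ξ} → ξ < α → ∃[ γ ] (C α γ × ξ < γ)
    C-above ξ<α =
      let γ , γ∈C , ξ+1≤γ = proj₂ (proj₁ (club α lim)) _ (limit-next lim ξ<α)
      in γ , γ∈C , <-≤-trans <-next ξ+1≤γ

    -- If the supremum of `C α` below `γ` is smaller than `γ`, it belongs to the closed set `C α`
    -- and is the predecessor.
    pred-or-acc : ∀ γ → C α γ → ∀ δ → C α δ → δ < γ →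
                  (∃[ δ ] IsPred (C α) δ γ) ⊎ γ ∈ Defs.acc κ (C α)
    pred-or-acc γ γ∈C δ δ∈C δ<γ with em {P = ∃[ δ ] IsPred (C α) δ γ}
    ... | yes pred   = inj₁ pred
    ... | no no-pred = inj₂ (γ∈C , ((λ ξ (_ , ξ<γ) → inj₁ ξ<γ) , least-bound) , δ , δ<γ)
      where
      Bound : Pred Ord ℓ
      Bound b = ∀ ξ → C α ξ × ξ < γ → ξ ≤ b
      least-bound : ∀ b → Bound b → γ ≤ b
      least-bound b bound = ≮⇒≥ λ b<γ → no-pred (s , s∈C (s<γ b<γ) , s<γ b<γ , λ ξ ξ∈C ξ<γ → s-bound ξ (ξ∈C , ξ<γ))
        where
        s : Ord
        s = μ Bound
        s-bound : Bound s
        s-bound = μ-∈ Bound (b , bound)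
        s<γ : b < γ → s < γ
        s<γ b<γ = ≤-<-trans (μ-≤ Bound bound) b<γ
        s∈C : s < γ → C α s
        s∈C s<γ = by-contradiction λ s∉C →
          let below : ∀ {ξ} → C α ξ × ξ < γ → ξ < s
              below {ξ} ξ∈ = ≰⇒> (λ s≤ξ →
                s∉C (subst (C α) (≤-antisym (s-bound ξ ξ∈) s≤ξ) (proj₁ ξ∈)))
          in s∉C (proj₂ (club α lim) s (<-trans s<γ (C⊆α γ∈C)) (δ , below (δ∈C , δ<γ))
            ( (λ ξ (_ , ξ<s) → inj₁ ξ<s)
            , (λ b′ bound′ → μ-≤ Bound (λ ξ ξ∈ → bound′ ξ (proj₁ ξ∈ , below ξ∈)))))

    module Accumulation {γ : Ord} (γ∈acc : γ ∈ Defs.acc κ (C α)) where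

      acc-cofinal : ∀ {ξ} → ξ < γ → ∃[ δ ] ((C α δ × δ < γ) × ξ < δ)
      acc-cofinal = sup-cofinal (proj₁ (proj₂ γ∈acc))

      acc-limit : Limit κ γ
      acc-limit = proj₂ (proj₂ γ∈acc) , (λ ξ ξ<γ → inj₁ ξ<γ) ,
        λ β bound → proj₂ (proj₁ (proj₂ γ∈acc)) β (λ ξ (_ , ξ<γ) → bound ξ ξ<γ)

      -- The initial segment supplied by coherence contains everything below `γ`, because it
      -- contains `C γ`, which is cofinal in `γ`.
      acc-agree : Agree γ levels (C α) levels (C γ)
      acc-agree with coherent α γ γ∈acc
      ... | I , I-seg , sub , sup = agree (λ _ _ _ _ → refl) Cα⇒Cγ (λ δ _ δ∈Cγ → proj₁ (sub δ∈Cγ))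
        where
        Cα⇒Cγ : ∀ δ → δ < γ → C α δ → C γ δ
        Cα⇒Cγ δ δ<γ δ∈Cα with proj₂ (proj₁ (club γ acc-limit)) δ δ<γ
        ... | η , η∈Cγ , inj₁ δ<η  = sup (δ∈Cα , I-seg δ η δ<η (proj₂ (sub η∈Cγ)))
        ... | η , η∈Cγ , inj₂ refl = η∈Cγ

  -- The levels form a normal tree with an ascent path

  record Along (α : Ord) (τ : Tag) : Set ℓ where
    field
      start : e (startLevel τ) (startIndex τ) ≈[ startLevel τ ] branch levels (C α) τ
      at    : ∀ δ → C α δ → startLevel τ < δ →
              e δ (path levels (C α) τ δ) ≈[ δ ] branch levels (C α) τ

  -- `up` is normality. `along` is carried through the induction for accumulation points, where the
  -- earlier branch with the same tag supplies an extension of all previous choices.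
  record Invariant (α : Ord) : Set ℓ where
    field
      down   : ∀ i β → β ≤ α → ∃[ j ] (e β j ≈[ β ] e α i)
      up     : ∀ β j → β ≤ α → ∃[ i ] (e β j ≈[ β ] e α i)
      inTree : ∀ n → ∃[ i ] (f α n ≈[ α ] e α i)
      ascent : ∀ β → β < α → ∃[ N ] (∀ n → N ℕ.≤ n → f β n ≈[ β ] f α n)
      along  : Limit κ α → ∀ τ → Valid τ → startLevel τ < α → Along α τ

  module LimitStep {α : Ord} (lim : Limit κ α) (ih : ∀ β → β < α → Invariant β) where
    open LimitLevel lim
    open Invariant

    module OnPath (τ : Tag) (valid : Valid τ) (start<α : startLevel τ < α) where

      g : Ord → Ord
      g = path levels (C α) τ

      Extension : Ord → Pred Ord ℓ
      Extension γ = Extends levels (C α) τ γ g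

      extension-from-pred : ∀ {γ δ i} → IsPred (C α) δ γ → startLevel τ < δ → Extension δ (g δ) →
                            e δ (g δ) ≈[ δ ] e γ i → Extension γ i
      extension-from-pred {γ} {δ} {i} (δ∈C , δ<γ , δ-max) start<δ (_ , start≈ , earlier≈) δ≈i =
        <-trans start<δ δ<γ , ≈-trans start≈ (≈-restrict (inj₁ start<δ) δ≈i) , below
        where
        below : ∀ η → C α η → startLevel τ < η → η < γ → e η (g η) ≈[ η ] e γ i
        below η η∈C start<η η<γ with δ-max η η∈C η<γ
        ... | inj₁ η<δ  = ≈-trans (earlier≈ η η∈C start<η η<δ) (≈-restrict (inj₁ η<δ) δ≈i)
        ... | inj₂ refl = δ≈i

      -- Normality gives an extension at the first element and after a predecessor. At an
      -- accumulation point `γ` the choices so far are those of the branch along `C γ` with the same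
      -- tag, which is a node of level `γ`.
      extendible : ∀ γ → C α γ → startLevel τ < γ →
                   (∀ δ → δ < γ → C α δ → startLevel τ < δ → Extension δ (g δ)) →
                   Satisfiable (Extension γ)
      extendible γ γ∈C start<γ earlier
        with em {P = ∃[ δ ] (C α δ × startLevel τ < δ × δ < γ)}
      ... | no none =
        let i , start≈i = up (ih γ (C⊆α γ∈C)) (startLevel τ) (startIndex τ) (inj₁ start<γ)
        in i , start<γ , start≈i , λ δ δ∈C start<δ δ<γ → ⊥-elim (none (δ , δ∈C , start<δ , δ<γ))
      ... | yes (δ₀ , δ₀∈C , start<δ₀ , δ₀<γ) with pred-or-acc γ γ∈C δ₀ δ₀∈C δ₀<γ
      ... | inj₁ (δ , pred@(δ∈C , δ<γ , δ-max)) =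
        let start<δ = <-≤-trans start<δ₀ (δ-max δ₀ δ₀∈C δ₀<γ)
            i , δ≈i = up (ih γ (C⊆α γ∈C)) δ (g δ) (inj₁ δ<γ)
        in i , extension-from-pred pred start<δ (earlier δ δ<γ δ∈C start<δ) δ≈i
      ... | inj₂ γ∈acc =
        i , start<γ , ≈-trans start (≈-restrict (inj₁ start<γ) (≈-sym i≈branch)) , below
        where
        open Accumulation γ∈acc
        open Along (along (ih γ (C⊆α γ∈C)) acc-limit τ valid start<γ)
        on-γ     = limit-branch acc-limit τ valid start<γ
        i        = proj₁ on-γ
        i≈branch = proj₂ on-γ
        below : ∀ δ → C α δ → startLevel τ < δ → δ < γ → e δ (g δ) ≈[ δ ] e γ i
        below δ δ∈C start<δ δ<γ =
          subst (λ j → e δ j ≈[ δ ] e γ i) (sym (path-cong acc-agree τ δ δ<γ))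
            (≈-trans (at δ (Agree.sub acc-agree δ δ<γ δ∈C) start<δ)
                     (≈-restrict (inj₁ δ<γ) (≈-sym i≈branch)))

      extends : ∀ γ → C α γ → startLevel τ < γ → Extension γ (g γ)
      extends = <-induction _ λ γ earlier γ∈C start<γ →
        path-extends levels (C α) τ (extendible γ γ∈C start<γ earlier)

      some-extension : ∀ γ → C α γ → startLevel τ < γ → Satisfiable (Extension γ)
      some-extension γ γ∈C start<γ = g γ , extends γ γ∈C start<γ

      Above : Ord → Pred Ord ℓ
      Above ξ γ = C α γ × startLevel τ < γ × ξ < γ

      above : ∀ {ξ} → ξ < α → Satisfiable (Above ξ)
      above {ξ} ξ<α =
        let γ , γ∈C , m<γ = C-above (⊔-lub-< start<α ξ<α)
        in γ , γ∈C , ≤-<-trans (≤-⊔ˡ _ _) m<γ , ≤-<-trans (≤-⊔ʳ _ _) m<γ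

      along-α : Along α τ
      along-α = record
        { start = λ ξ ξ<start →
            let γ∈C , start<γ , ξ<γ = μ-∈ (Above ξ) (above (<-trans ξ<start start<α))
            in proj₁ (proj₂ (extends _ γ∈C start<γ)) ξ ξ<start
        ; at    = at
        }
        where
        at : ∀ δ → C α δ → startLevel τ < δ → e δ (g δ) ≈[ δ ] branch levels (C α) τ
        at δ δ∈C start<δ ξ ξ<δ = go (μ-≤ (Above ξ) above-δ)
          where
          above-δ : Above ξ δ
          above-δ = δ∈C , start<δ , ξ<δ
          go : μ (Above ξ) ≤ δ → e δ (g δ) ξ ≡ e (μ (Above ξ)) (g (μ (Above ξ))) ξ
          go (inj₂ eq)  = sym (cong (λ γ → e γ (g γ) ξ) eq)
          go (inj₁ γ<δ) =
            let γ∈C , start<γ , ξ<γ = μ-∈ (Above ξ) (δ , above-δ)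
            in sym (proj₂ (proj₂ (extends δ δ∈C start<δ)) _ γ∈C start<γ γ<δ ξ ξ<γ)

    -- At accumulation points of C α the branches meet the ascent path again,
    -- and every other step leaves it in only finitely many entries.
    follows-ascent : ∀ γ → C α γ → zero < γ →
      ∃[ N ] (∀ n → N ℕ.≤ n → f γ n ≈[ γ ] e γ (path levels (C α) (inj₂ n) γ))
    follows-ascent = <-induction _ step
      where
      Goal : Ord → Set ℓ
      Goal γ = ∃[ N ] (∀ n → N ℕ.≤ n → f γ n ≈[ γ ] e γ (path levels (C α) (inj₂ n) γ))

      module P (n : ℕ) = OnPath (inj₂ n) _ (limit-zero lim)

      prefers : ∀ γ → C α γ → zero < γ →
        (∃[ N ] (∀ n → N ℕ.≤ n → ∀ i → f γ n ≈[ γ ] e γ i → P.Extension n γ i)) → Goal γ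
      prefers γ γ∈C 0<γ (N , ext) with eventually-not-late (C α) γ
      ... | N′ , ¬late = N ℕ.⊔ N′ , λ n N⊔N′≤n →
        let i , f≈i = inTree (ih γ (C⊆α γ∈C)) n in
        ≈-sym (proj₁ (path-preferred levels (C α) (inj₂ n) (P.some-extension n γ γ∈C 0<γ)
          (i , (≈-sym f≈i , ¬late (ℕ.suc n) (ℕ.m≤n⇒m≤1+n (ℕ.≤-trans (ℕ.m≤n⊔m N N′) N⊔N′≤n))) ,
           ext n (ℕ.≤-trans (ℕ.m≤m⊔n N N′) N⊔N′≤n) i f≈i)))

      step : ∀ γ → (∀ δ → δ < γ → C α δ → zero < δ → Goal δ) → C α γ → zero < γ → Goal γ
      step γ rec γ∈C 0<γ with em {P = ∃[ δ ] (C α δ × zero < δ × δ < γ)}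
      ... | no none = prefers γ γ∈C 0<γ (0 , λ n _ i _ →
        0<γ , (λ ξ ξ<0 → ⊥-elim (≮zero ξ<0)) ,
        λ δ δ∈C 0<δ δ<γ → ⊥-elim (none (δ , δ∈C , 0<δ , δ<γ)))
      ... | yes (δ₀ , δ₀∈C , 0<δ₀ , δ₀<γ) with pred-or-acc γ γ∈C δ₀ δ₀∈C δ₀<γ
      ... | inj₁ (δ , pred@(δ∈C , δ<γ , δ-max)) = prefers γ γ∈C 0<γ (N ℕ.⊔ N′ , ext)
        where
        0<δ  = <-≤-trans 0<δ₀ (δ-max δ₀ δ₀∈C δ₀<γ)
        at-δ = rec δ δ<γ δ∈C 0<δ
        N    = proj₁ at-δ
        asc  = ascent (ih γ (C⊆α γ∈C)) δ δ<γ
        N′   = proj₁ asc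
        ext : ∀ n → N ℕ.⊔ N′ ℕ.≤ n → ∀ i → f γ n ≈[ γ ] e γ i → P.Extension n γ i
        ext n ≤n i f≈i = P.extension-from-pred n pred 0<δ (P.extends n δ δ∈C 0<δ)
          (≈-trans (≈-sym (proj₂ at-δ n (ℕ.≤-trans (ℕ.m≤m⊔n N N′) ≤n)))
            (≈-trans (proj₂ asc n (ℕ.≤-trans (ℕ.m≤n⊔m N N′) ≤n)) (≈-restrict (inj₁ δ<γ) f≈i)))
      -- No entry is lost here: `f γ n` is itself the branch with tag `inj₂ n` along `C γ`, whose
      -- choices are those made along `C α`.
      ... | inj₂ γ∈acc = 0 , λ n _ ξ ξ<γ →
        let open Along (along (ih γ (C⊆α γ∈C)) acc-limit (inj₂ n) _ 0<γ)
            δ , (δ∈C , δ<γ) , ξ<δ = acc-cofinal ξ<γ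
            0<δ = ≤-<-trans (zero-≤ ξ) ξ<δ
        in trans (f-limit acc-limit n ξ) (trans
             (sym (at δ (Agree.sub acc-agree δ δ<γ δ∈C) 0<δ ξ ξ<δ)) (trans
             (cong (λ j → e δ j ξ) (sym (path-cong acc-agree (inj₂ n) δ δ<γ)))
             (proj₂ (proj₂ (P.extends n γ γ∈C 0<γ)) δ δ∈C 0<δ δ<γ ξ ξ<δ)))
        where open Accumulation γ∈acc

    limit-invariant : Invariant α
    limit-invariant = record
      { down   = down-α
      ; up     = up-α
      ; inTree = λ n → let i , i≈ = limit-branch lim (inj₂ n) _ (limit-zero lim)
                       in i , λ ξ ξ<α → trans (f-limit lim n ξ) (sym (i≈ ξ ξ<α))
      ; ascent = ascent-α
      ; along  = λ _ τ valid start<α → OnPath.along-α τ valid start<α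
      }
      where
      down-α : ∀ i β → β ≤ α → ∃[ j ] (e β j ≈[ β ] e α i)
      down-α i β (inj₂ refl) = i , λ _ _ → refl
      down-α i β (inj₁ β<α) =
        let τ = decode α i
            open OnPath τ (decode-valid α i) (decode-startLevel lim i)
            γ , γ∈C , start<γ , β<γ = above β<α
            j , j≈ = down (ih γ (C⊆α γ∈C)) (g γ) β (inj₁ β<γ)
        in j , ≈-trans j≈ (≈-trans (≈-restrict (inj₁ β<γ) (Along.at along-α γ γ∈C start<γ))
                                   (λ ξ _ → sym (e-limit lim i ξ)))

      up-α : ∀ β j → β ≤ α → ∃[ i ] (e β j ≈[ β ] e α i)
      up-α β j (inj₂ refl) = j , λ _ _ → refl
      up-α β j (inj₁ β<α) with zero-≤ β
      -- Nodes of level zero have no valid tag, but every node extends the root.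
      ... | inj₂ refl = zero , λ ξ ξ<0 → ⊥-elim (≮zero ξ<0)
      ... | inj₁ 0<β =
        let x , x< , j≈x = small-index β j
            open OnPath (inj₁ (β , x)) (0<β , x<) β<α
            i , i≈ = limit-branch lim (inj₁ (β , x)) (0<β , x<) β<α
        in i , ≈-trans j≈x (≈-trans (Along.start along-α) (≈-restrict (inj₁ β<α) (≈-sym i≈)))

      ascent-α : ∀ β → β < α → ∃[ N ] (∀ n → N ℕ.≤ n → f β n ≈[ β ] f α n)
      ascent-α β β<α with C-above β<α
      ... | γ , γ∈C , β<γ with ascent (ih γ (C⊆α γ∈C)) β β<γ
                             | follows-ascent γ γ∈C (≤-<-trans (zero-≤ β) β<γ)
      ... | N , asc | N′ , follows = N ℕ.⊔ N′ , λ n ≤n →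
        ≈-trans (asc n (ℕ.≤-trans (ℕ.m≤m⊔n N N′) ≤n)) (≈-restrict (inj₁ β<γ)
          (≈-trans (follows n (ℕ.≤-trans (ℕ.m≤n⊔m N N′) ≤n))
            (≈-trans (Along.at (OnPath.along-α (inj₂ n) _ (limit-zero lim)) γ γ∈C (≤-<-trans (zero-≤ β) β<γ))
                     (λ ξ _ → sym (f-limit lim n ξ)))))

  next-invariant : ∀ {β} → Invariant β → Invariant (next β)
  next-invariant {β} inv = record
    { down   = down-β
    ; up     = up-β
    ; inTree = inTree-β
    ; ascent = ascent-β
    ; along  = λ lim → ⊥-elim (next-not-limit lim)
    }
    where
    open Invariant inv

    split : ∀ {γ} → γ ≤ next β → γ ≤ β ⊎ γ ≡ next β
    split (inj₁ γ<) = inj₁ (<-next⇒≤ γ<)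
    split (inj₂ eq) = inj₂ eq

    e-restrict : ∀ i → e β (proj₁ (unpair β i)) ≈[ β ] e (next β) i
    e-restrict i ξ ξ<β = sym (trans (e-next β i ξ) (snoc-≈ ξ ξ<β))

    f-restrict : ∀ n → f β n ≈[ β ] f (next β) n
    f-restrict n ξ ξ<β = sym (trans (f-next β n ξ) (snoc-≈ ξ ξ<β))

    down-β : ∀ i γ → γ ≤ next β → ∃[ j ] (e γ j ≈[ γ ] e (next β) i)
    down-β i γ γ≤ with split γ≤
    ... | inj₂ refl = i , λ _ _ → refl
    ... | inj₁ γ≤β  = let j , j≈ = down (proj₁ (unpair β i)) γ γ≤β
                      in j , ≈-trans j≈ (≈-restrict γ≤β (e-restrict i))

    up-β : ∀ γ j → γ ≤ next β → ∃[ i ] (e γ j ≈[ γ ] e (next β) i)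
    up-β γ j γ≤ with split γ≤
    ... | inj₂ refl = j , λ _ _ → refl
    ... | inj₁ γ≤β  =
      let i , j≈i = up γ j γ≤β
          k , k≈  = child β i (fin<hat 0)
      in k , ≈-trans j≈i (λ ξ ξ<γ → let ξ<β = <-≤-trans ξ<γ γ≤β in
           sym (trans (k≈ ξ (<-trans ξ<β <-next)) (snoc-≈ ξ ξ<β)))

    inTree-β : ∀ n → ∃[ i ] (f (next β) n ≈[ next β ] e (next β) i)
    inTree-β n =
      let i , f≈i = inTree n
          k , k≈  = child β i (fin<hat n)
      in k , λ ξ ξ< → trans (f-next β n ξ) (trans (snoc-cong f≈i ξ ξ<) (sym (k≈ ξ ξ<)))

    ascent-β : ∀ γ → γ < next β → ∃[ N ] (∀ n → N ℕ.≤ n → f γ n ≈[ γ ] f (next β) n)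
    ascent-β γ γ< with <-next⇒≤ γ<
    ... | inj₂ refl = 0 , λ n _ → f-restrict n
    ... | inj₁ γ<β  = let N , asc = ascent γ γ<β
                      in N , λ n N≤n → ≈-trans (asc n N≤n) (≈-restrict (inj₁ γ<β) (f-restrict n))

  zero-invariant : Invariant zero
  zero-invariant = record
    { down   = λ { i β (inj₁ β<0) → ⊥-elim (≮zero β<0) ; i β (inj₂ refl) → i , λ _ _ → refl }
    ; up     = λ { β j (inj₁ β<0) → ⊥-elim (≮zero β<0) ; β j (inj₂ refl) → j , λ _ _ → refl }
    ; inTree = λ n → zero , λ ξ ξ<0 → ⊥-elim (≮zero ξ<0)
    ; ascent = λ β β<0 → ⊥-elim (≮zero β<0)
    ; along  = λ lim → ⊥-elim (<-irrefl (limit-zero lim))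
    }

  invariant : ∀ α → Invariant α
  invariant = <-induction Invariant step
    where
    step : ∀ α → (∀ β → β < α → Invariant β) → Invariant α
    step α ih with shape α
    ... | isZero refl   = zero-invariant
    ... | isNext β refl = next-invariant (ih β <-next)
    ... | isLimit lim   = LimitStep.limit-invariant lim ih

  -- Consecutive elements of C α

  module Steps {α : Ord} (lim : Limit κ α) {β : Ord} (β∈C : C α β) where
    open LimitLevel lim

    After : Ord → Pred Ord ℓ
    After δ γ = C α γ × δ < γ

    steps : ℕ → Ord
    steps 0         = β
    steps (ℕ.suc n) = μ (After (steps n))

    steps-∈ : ∀ n → C α (steps n)
    steps-after : ∀ n → After (steps n) (steps (ℕ.suc n))
    steps-∈ 0         = β∈C
    steps-∈ (ℕ.suc n) = proj₁ (steps-after n)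
    steps-after n = μ-∈ (After (steps n)) (C-above (C⊆α (steps-∈ n)))

    steps-pred : ∀ n → IsPred (C α) (steps n) (steps (ℕ.suc n))
    steps-pred n = steps-∈ n , proj₂ (steps-after n) , λ ξ ξ∈C ξ< →
      ≮⇒≥ (λ n<ξ → ≤⇒≯ (μ-≤ (After (steps n)) (ξ∈C , n<ξ)) ξ<)

    -- `Late` is only a lower bound on the position, so the block may start anywhere after an
    -- accumulation point.
    steps-late : ∀ n → Late (C α) n (steps n)
    steps-late 0         = _
    steps-late (ℕ.suc n) = steps n , steps-pred n , steps-late n

    steps-mono : ∀ {m n} → m ℕ.< n → steps m < steps n
    steps-mono {m} {ℕ.suc n} (ℕ.s≤s m≤n) with ℕ.m≤n⇒m<n∨m≡n m≤n
    ... | inj₁ m<n  = <-trans (steps-mono m<n) (proj₂ (steps-after n))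
    ... | inj₂ refl = proj₂ (steps-after n)

    ≤-steps : ∀ n → β ≤ steps n
    ≤-steps 0         = ≤-refl
    ≤-steps (ℕ.suc n) = inj₁ (steps-mono {0} {ℕ.suc n} (ℕ.s≤s ℕ.z≤n))

    steps-onto : ∀ n {ξ} → C α ξ → β ≤ ξ → ξ < steps n → ∃[ m ] (m ℕ.< n × steps m ≡ ξ)
    steps-onto 0         ξ∈C β≤ξ ξ<β = ⊥-elim (≤⇒≯ β≤ξ ξ<β)
    steps-onto (ℕ.suc n) ξ∈C β≤ξ ξ< with proj₂ (proj₂ (steps-pred n)) _ ξ∈C ξ<
    ... | inj₂ refl = n , ℕ.n<1+n n , refl
    ... | inj₁ ξ<n  = let m , m<n , eq = steps-onto n ξ∈C β≤ξ ξ<n in m , ℕ.m<n⇒m<1+n m<n , eq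

    -- The index is `suc n` because `steps 0` has no element of the block below it, while `succ-ω`
    -- demands a positive order type.
    steps-succ-ω : ∀ n → succ-ω κ (C α ∖ ↓ β) (steps (ℕ.suc n))
    steps-succ-ω n =
      (steps-∈ (ℕ.suc n) , ≤⇒≯ (≤-steps (ℕ.suc n))) , ℕ.suc n , ℕ.s≤s ℕ.z≤n ,
      (λ i → steps (Fin.toℕ i)) , steps-mono ,
      (λ ((ξ∈C , ξ≮β) , ξ<) →
        let m , m<n , eq = steps-onto (ℕ.suc n) ξ∈C (≮⇒≥ ξ≮β) ξ<
        in Fin.fromℕ< m<n , trans (cong steps (Fin.toℕ-fromℕ< m<n)) eq) ,
      λ { (i , refl) → (steps-∈ (Fin.toℕ i) , ≤⇒≯ (≤-steps (Fin.toℕ i))) , steps-mono (Fin.toℕ<n i) }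

  -- The branch of τ ignores the ascent path after delay τ steps from an
  -- accumulation point.
  delay : Tag → ℕ
  delay (inj₁ _) = 0
  delay (inj₂ n) = n

  late-not-preferred : ∀ {p D} τ {γ} → Late D (ℕ.suc (delay τ)) γ → ¬ Satisfiable (Preferred p D τ γ)
  late-not-preferred (inj₁ _) late (_ , ())
  late-not-preferred (inj₂ n) late (_ , _ , ¬late) = ¬late late

  Comparable : Ord → Ord → Ord → Ord → Set ℓ
  Comparable η j δ i = (η ≤ δ × e η j ≈[ η ] e δ i) ⊎ (δ ≤ η × e δ i ≈[ δ ] e η j)

  -- The tree of sequences

  open Seq
  open Invariant

  node : Ord → (Ord → Ord) → Seq κ
  node α t = record { dom = α ; val = λ ξ _ → t ξ }

  Matches : Seq κ → Ord → Set ℓ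
  Matches s i = ∀ ξ (ξ< : ξ < dom s) → val s ξ ξ< ≡ e (dom s) i ξ

  T : Pred (Seq κ) ℓ
  T s = Satisfiable (Matches s)

  Graph⊆⇒≤ : ∀ {s t} → Graph κ s ⊆ Graph κ t → dom s ≤ dom t
  Graph⊆⇒≤ {s} {t} s⊆t = ≮⇒≥ λ t<s → <-irrefl (proj₁ (s⊆t {dom t , val s (dom t) t<s} (t<s , refl)))

  Graph⊆⇒≡ : ∀ {s t} → Graph κ s ⊆ Graph κ t →
             ∀ ξ (ξ<s : ξ < dom s) (ξ<t : ξ < dom t) → val s ξ ξ<s ≡ val t ξ ξ<t
  Graph⊆⇒≡ {s} s⊆t ξ ξ<s ξ<t = sym (proj₂ (s⊆t {ξ , val s ξ ξ<s} (ξ<s , refl)))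

  ≈ₛ⇒dom≡ : ∀ {s t} → _≈ₛ_ κ s t → dom s ≡ dom t
  ≈ₛ⇒dom≡ {s} {t} (s⊆t , t⊆s) = ≤-antisym (Graph⊆⇒≤ {s} {t} s⊆t) (Graph⊆⇒≤ {t} {s} t⊆s)

  Graph-⊆ : ∀ {s t} → dom s ≤ dom t →
            (∀ ξ (ξ<s : ξ < dom s) (ξ<t : ξ < dom t) → val s ξ ξ<s ≡ val t ξ ξ<t) →
            Graph κ s ⊆ Graph κ t
  Graph-⊆ s≤t s≡t {ξ , η} (ξ<s , eq) =
    <-≤-trans ξ<s s≤t , trans (sym (s≡t ξ ξ<s (<-≤-trans ξ<s s≤t))) eq

  ⊊-intro : ∀ {s t} → dom s < dom t →
            (∀ ξ (ξ<s : ξ < dom s) (ξ<t : ξ < dom t) → val s ξ ξ<s ≡ val t ξ ξ<t) →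
            _⊊_ κ s t
  ⊊-intro {s} {t} s<t s≡t =
    Graph-⊆ {s} {t} (inj₁ s<t) s≡t , λ t⊆s → ≤⇒≯ (Graph⊆⇒≤ {t} {s} t⊆s) s<t

  downwardClosed : DownwardClosed κ T
  downwardClosed s t s⊆t (i , t-matches) =
    let j , j≈i = down (invariant (dom t)) i (dom s) s≤t
    in j , λ ξ ξ<s → let ξ<t = <-≤-trans ξ<s s≤t in
      trans (Graph⊆⇒≡ {s} {t} s⊆t ξ ξ<s ξ<t) (trans (t-matches ξ ξ<t) (sym (j≈i ξ ξ<s)))
    where
    s≤t : dom s ≤ dom t
    s≤t = Graph⊆⇒≤ {s} {t} s⊆t

  prolific : Prolific κ T
  prolific _ x ((j , matches) , refl) i i∈ = s , (s⊆ , ⊆s) , k , λ _ _ → refl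
    where
    α = dom x
    i< : i ∈ ω κ ∪ ↓ α → i < hat α
    i< (inj₁ i∈ω) = <-≤-trans (ω⇒<ω₀ i∈ω) (≤-⊔ˡ _ _)
    i< (inj₂ i<α) = <-≤-trans i<α (≤-⊔ʳ _ _)
    k : Ord
    k = proj₁ (child α j (i< i∈))
    s : Seq κ
    s = node (next α) (e (next α) k)
    k≈ : e (next α) k ≈[ next α ] snoc α (e α j) i
    k≈ = proj₂ (child α j (i< i∈))
    s⊆ : Graph κ s ⊆ Graph κ x ∪ (_≡ (α , i))
    s⊆ {ξ , η} (ξ<α+1 , refl) with <-next⇒≤ ξ<α+1
    ... | inj₁ ξ<α  = inj₁ (ξ<α , trans (matches ξ ξ<α) (sym (trans (k≈ ξ ξ<α+1) (snoc-≈ ξ ξ<α))))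
    ... | inj₂ refl = inj₂ (cong (α ,_) (trans (k≈ α ξ<α+1) snoc-last))
    ⊆s : Graph κ x ∪ (_≡ (α , i)) ⊆ Graph κ s
    ⊆s {ξ , η} (inj₁ (ξ<α , eq)) = <-trans ξ<α <-next ,
      trans (trans (k≈ ξ (<-trans ξ<α <-next)) (snoc-≈ ξ ξ<α)) (trans (sym (matches ξ ξ<α)) eq)
    ⊆s (inj₂ refl) = <-next , trans (k≈ α <-next) snoc-last

  -- The least matching index is invariant under `_≈ₛ_`, as a map out of the setoid of nodes has to
  -- be.
  index : Seq κ → Ord
  index s = μ (Matches s)

  index-matches : ∀ {s} → s ∈ T → Matches s (index s)
  index-matches {s} s∈T = μ-∈ (Matches s) s∈T

  index-< : ∀ {s} → s ∈ T → index s < hat (dom s)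
  index-< {s} (i , matches) =
    let i′ , i′< , i≈i′ = small-index (dom s) i
    in ≤-<-trans (μ-≤ (Matches s) (λ ξ ξ< → trans (matches ξ ξ<) (i≈i′ ξ ξ<))) i′<

  index-cong : ∀ {s t} → _≈ₛ_ κ s t → index s ≡ index t
  index-cong {s} {t} s≈t = μ-cong (to s t s≈t , to t s (swap s≈t))
    where
    to : ∀ s t → _≈ₛ_ κ s t → Matches s ⊆ Matches t
    to s t s≈t@(s⊆t , t⊆s) {i} matches ξ ξ<t =
      let ξ<s = <-≤-trans ξ<t (Graph⊆⇒≤ {t} {s} t⊆s) in
      trans (Graph⊆⇒≡ {t} {s} t⊆s ξ ξ<t ξ<s) (trans (matches ξ ξ<s)
        (cong (λ α → e α i ξ) (≈ₛ⇒dom≡ {s} {t} s≈t)))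

  index-injective : ∀ {s t} → s ∈ T → t ∈ T → dom s ≡ dom t → index s ≡ index t → _≈ₛ_ κ s t
  index-injective {s} {t} s∈T t∈T dom≡ index≡ =
    Graph-⊆ {s} {t} (inj₂ dom≡) (λ ξ ξ<s ξ<t → eq ξ ξ<s ξ<t) ,
    Graph-⊆ {t} {s} (inj₂ (sym dom≡)) (λ ξ ξ<t ξ<s → sym (eq ξ ξ<s ξ<t))
    where
    eq : ∀ ξ (ξ<s : ξ < dom s) (ξ<t : ξ < dom t) → val s ξ ξ<s ≡ val t ξ ξ<t
    eq ξ ξ<s ξ<t = trans (index-matches {s} s∈T ξ ξ<s) (trans
      (trans (cong (λ i → e (dom s) i ξ) index≡) (cong (λ α → e α (index t) ξ) dom≡))
      (sym (index-matches {t} t∈T ξ ξ<t)))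

  level≲hat : ∀ α → Subset (Seqₛ κ) (LevelOf κ T α) ≲ Subset (setoid Ord) (↓ (hat α))
  level≲hat α = record
    { to        = λ (s , s∈T , dom≡) → index s , subst (λ α → index s < hat α) dom≡ (index-< {s} s∈T)
    ; cong      = λ {(s , _)} {(t , _)} s≈t → index-cong {s} {t} s≈t
    ; injective = λ {(s , s∈T , s≡α)} {(t , t∈T , t≡α)} →
        index-injective {s} {t} s∈T t∈T (trans s≡α (sym t≡α))
    }

  ≲-trans : ∀ {a b c d p q} {X : Setoid a b} {Y : Setoid c d} {W : Setoid p q} → X ≲ Y → Y ≲ W → X ≲ W
  ≲-trans X≲Y Y≲W = record
    { to        = Injection.to Y≲W ∘ Injection.to X≲Y
    ; cong      = Injection.cong Y≲W ∘ Injection.cong X≲Y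
    ; injective = Injection.injective X≲Y ∘ Injection.injective Y≲W
    }

  slim : Slim κ T
  slim α with <-≤-dec α ω₀
  ... | inj₂ ω≤α = inj₁ (subst (λ β → Subset (Seqₛ κ) (LevelOf κ T α) ≲ Subset (setoid Ord) (↓ β))
                               (hat-of-infinite ω≤α) (level≲hat α))
  ... | inj₁ α<ω = inj₂ (≲-trans (level≲hat α) (record
    { to        = nat ∘ proj₁
    ; cong      = cong nat
    ; injective = λ {(ξ , ξ<)} {(η , η<)} eq →
        trans (sym (fin-nat (finite ξ<))) (trans (cong fin eq) (fin-nat (finite η<)))
    }))
    where
    finite : ∀ {ξ} → ξ < hat α → ∃[ n ] (ξ ≡ fin n)
    finite ξ< = <ω₀⇒fin (<-≤-trans ξ< (⊔-lub ≤-refl (inj₁ α<ω)))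

  path-node : Ord → ℕ → Seq κ
  path-node α n = node α (f α n)

  ascentPath : AscentPath κ 𝓕-fin T path-node
  ascentPath = (λ α n → inTree′ α n , refl) , λ α β α<β →
    let N , asc = ascent (invariant β) α α<β in
    upTo N , λ n ¬⊊ → by-contradiction (λ n∉ → ¬⊊ (⊊-intro {path-node α n} {path-node β n} α<β
      (λ ξ ξ<α _ → asc n (ℕ.≮⇒≥ (λ n<N → n∉ (∈-upTo⁺ n<N))) ξ ξ<α)))
    where
    inTree′ : ∀ α n → path-node α n ∈ T
    inTree′ α n = let i , f≈i = inTree (invariant α) n in i , f≈i

  injectivePath : InjectivePath κ 𝓕-fin path-node
  -- At this level the `n`-th entry is the one-term sequence with value `fin n`.
  injectivePath = next zero , U , ([] , λ n n∉U → ⊥-elim (n∉U _)) , λ m n _ _ m≈n →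
    fin-injective (trans (sym (last m)) (trans
      (Graph⊆⇒≡ {path-node (next zero) m} {path-node (next zero) n} (proj₁ m≈n) zero <-next <-next)
      (last n)))
    where
    last : ∀ n → f (next zero) n zero ≡ fin n
    last n = trans (f-next zero n zero) snoc-last

  small-levels : ∀ α → Subset (Seqₛ κ) (LevelOf κ T α) ≺ setoid Ord
  small-levels α =
    ≲-trans (level≲hat α) (proj₁ (cardinal (hat α))) ,
    λ Ord≲ → proj₂ (cardinal (hat α)) (≲-trans Ord≲ (level≲hat α))

  -- Sealing of predense sets, and the Souslin property.

  module Sealing
    (guess : ∀ (A : Pred Ord ℓ) → Stationary κ (λ α → A ∩ ↓ α ≐ Z α))
    (proxy : ∀ (A : Ord → Pred Ord ℓ) → (∀ i → i ∈ 𝟏 κ → CofinalIn κ U (A i)) →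
       ∀ S → S ∈ ｛κ｝ κ →
       Stationary κ (S ∩ λ α → ∀ i → i ∈ ↓ α ∩ 𝟏 κ →
         IsSup κ (λ β → β ∈ C α × succ-ω κ (C α ∖ ↓ β) ⊆ A i) α))
    where

    module Predense
      (D : Ord → Ord → Set ℓ)
      (predense : ∀ δ i → ∃[ η ] ∃[ j ] (D η j × Comparable η j δ i))
      where

      private
        witnessLevel witnessIndex : Ord → Ord → Ord
        witnessLevel δ i = proj₁ (predense δ i)
        witnessIndex δ i = proj₁ (proj₂ (predense δ i))

        -- Both a witness and its code must fall below a closure point `γ` for the witness to appear
        -- in `Z γ`. Indices below `hat δ` represent all nodes, so regularity applies.
        bound : ∀ δ → ∃[ β ] (∀ i → i < hat δ → witnessLevel δ i ⊔ₒ gödel (witnessLevel δ i , witnessIndex δ i) < β)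
        bound δ = regular (hat δ) (λ i → witnessLevel δ i ⊔ₒ gödel (witnessLevel δ i , witnessIndex δ i))

        Closed : Pred Ord ℓ
        Closed γ = ∀ δ → δ < γ → proj₁ (bound δ) < γ

        Codes : Pred Ord ℓ
        Codes ξ = ∃[ η ] ∃[ j ] (gödel (η , j) ≡ ξ × D η j)

        Guessed : Pred Ord ℓ
        Guessed γ = (Codes ∩ ↓ γ ≐ Z γ) × Closed γ

        guessed-cofinal : CofinalIn κ U Guessed
        guessed-cofinal = (λ _ → _) , λ β _ →
          let γ , guessed , β<γ , closed = guess Codes _ (closurePoints-club (λ δ → proj₁ (bound δ)) β)
          in γ , (guessed , closed) , inj₁ β<γ

        -- Normality lifts the upper one of the node and its comparable witness to level `γ`;
        -- closure puts the witness below `γ`, and the correct guess makes the result sealed.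
        sealed-extension : ∀ {γ δ} x → Guessed γ → δ < γ →
                           ∃[ i ] (Sealed levels γ i × e δ x ≈[ δ ] e γ i)
        sealed-extension {γ} {δ} x ((codes⊆Z , _) , closed) δ<γ = go (proj₂ (proj₂ (proj₂ (predense δ x′))))
          where
          x′   = proj₁ (small-index δ x)
          x≈x′ = proj₂ (proj₂ (small-index δ x))
          η    = witnessLevel δ x′
          j    = witnessIndex δ x′
          small : η ⊔ₒ gödel (η , j) < γ
          small = <-trans (proj₂ (bound δ) x′ (proj₁ (proj₂ (small-index δ x)))) (closed δ δ<γ)
          η<γ : η < γ
          η<γ = ≤-<-trans (≤-⊔ˡ _ _) small
          seal : ∀ {i} → e η j ≈[ η ] e γ i → Sealed levels γ i
          seal η≈i = η , j , η<γ ,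
            codes⊆Z ((η , j , refl , proj₁ (proj₂ (proj₂ (predense δ x′)))) , ≤-<-trans (≤-⊔ʳ _ _) small) ,
            η≈i
          go : Comparable η j δ x′ → ∃[ i ] (Sealed levels γ i × e δ x ≈[ δ ] e γ i)
          go (inj₁ (η≤δ , η≈δ)) =
            let i , δ≈i = Invariant.up (invariant γ) δ x′ (inj₁ δ<γ)
            in i , seal (≈-trans η≈δ (≈-restrict η≤δ δ≈i)) , ≈-trans x≈x′ δ≈i
          go (inj₂ (δ≤η , δ≈η)) =
            let i , η≈i = Invariant.up (invariant γ) η j (inj₁ η<γ)
            in i , seal η≈i , ≈-trans x≈x′ (≈-trans δ≈η (≈-restrict δ≤η η≈i))

        sealed⇒D : ∀ {γ i} → Guessed γ → Sealed levels γ i → ∃[ δ ] ∃[ j ] (δ < γ × D δ j × e δ j ≈[ δ ] e γ i)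
        sealed⇒D ((_ , Z⊆codes) , _) (δ , j , δ<γ , z , δ≈i) with proj₁ (Z⊆codes z)
        ... | η , k , eq , d with gödel-injective eq
        ... | refl = δ , j , δ<γ , d , δ≈i

        Good : Pred Ord ℓ
        Good α = IsSup κ (λ β → β ∈ C α × succ-ω κ (C α ∖ ↓ β) ⊆ Guessed) α

        good : ∃[ α ] (Limit κ α × Good α)
        good =
          -- Meeting the club of closure points of `next` makes `α` a limit.
          let α , (_ , isSup) , 0<α , closed = proxy (λ _ → Guessed) (λ _ _ → guessed-cofinal) U
                                                 ((λ _ → _) , (λ _ → _)) _ (closurePoints-club next zero)
          in α , limit-of-next-closed 0<α closed , isSup zero (0<α , λ _ → ≮zero)

      abstract
        sealing : ∃[ α ] (∀ i → ∃[ δ ] ∃[ j ] (δ < α × D δ j × e δ j ≈[ δ ] e α i))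
        sealing = α , seal
          where
          α : Ord
          α = proj₁ good
          lim : Limit κ α
          lim = proj₁ (proj₂ good)
          open LimitLevel lim
          seal : ∀ i → ∃[ δ ] ∃[ j ] (δ < α × D δ j × e δ j ≈[ δ ] e α i)
          seal i = result
            where
            τ : Tag
            τ = decode α i
            open LimitStep.OnPath lim (λ β _ → invariant β) τ (decode-valid α i) (decode-startLevel lim i)
            block : ∃[ β ] ((C α β × succ-ω κ (C α ∖ ↓ β) ⊆ Guessed) × startLevel τ < β)
            block = sup-cofinal (proj₂ (proj₂ good)) (decode-startLevel lim i)
            open Steps lim (proj₁ (proj₁ (proj₂ block)))
            δ γ : Ord
            δ = steps (delay τ)
            -- Late enough that the branch no longer prefers the ascent path; being a positive step
            -- of the block, it also lies in `Guessed`.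
            γ = steps (ℕ.suc (delay τ))
            γ∈C : C α γ
            γ∈C = steps-∈ (ℕ.suc (delay τ))
            start<δ : startLevel τ < δ
            start<δ = <-≤-trans (proj₂ (proj₂ block)) (≤-steps (delay τ))
            δ<γ : δ < γ
            δ<γ = proj₂ (steps-after (delay τ))
            start<γ : startLevel τ < γ
            start<γ = <-trans start<δ δ<γ
            guessed : Guessed γ
            guessed = proj₂ (proj₁ (proj₂ block)) (steps-succ-ω (delay τ))
            sealed : Sealed levels γ (g γ)
            sealed = path-sealed levels (C α) τ (some-extension γ γ∈C start<γ)
              (late-not-preferred {levels} τ (steps-late (ℕ.suc (delay τ))))
              (let k , isSealed , δ≈k = sealed-extension (g δ) guessed δ<γ
               in k , isSealed , extension-from-pred (steps-pred (delay τ)) start<δ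
                                   (extends δ (steps-∈ (delay τ)) start<δ) δ≈k)
            result : ∃[ δ ] ∃[ j ] (δ < α × D δ j × e δ j ≈[ δ ] e α i)
            result =
              let η , j , η<γ , d , η≈ = sealed⇒D guessed sealed
              in η , j , <-trans η<γ (C⊆α γ∈C) , d ,
                 ≈-trans η≈ (≈-restrict (inj₁ η<γ)
                   (≈-trans (Along.at along-α γ γ∈C start<γ) (λ ξ _ → sym (e-limit lim i ξ))))


    module Branch (B : Pred (Seq κ) ℓ) (cofinal : CofinalBranch κ T B) where

      coherent-values : ∀ {s t} → s ∈ B → t ∈ B →
        ∀ ξ (ξ<s : ξ < dom s) (ξ<t : ξ < dom t) → val s ξ ξ<s ≡ val t ξ ξ<t
      coherent-values {s} {t} s∈B t∈B ξ ξ<s ξ<t with proj₁ (proj₂ cofinal) s t s∈B t∈B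
      ... | inj₁ (s⊆t , _)        = Graph⊆⇒≡ {s} {t} s⊆t ξ ξ<s ξ<t
      ... | inj₂ (inj₁ (s⊆t , _)) = Graph⊆⇒≡ {s} {t} s⊆t ξ ξ<s ξ<t
      ... | inj₂ (inj₂ (t⊆s , _)) = sym (Graph⊆⇒≡ {t} {s} t⊆s ξ ξ<t ξ<s)

      On Off : Ord → Ord → Set ℓ
      On  δ i = ∃[ b ] (b ∈ B × dom b ≡ δ × Matches b i)
      Off δ i = ¬ On δ i

      -- Of two distinct children of a node, at most one is on the branch.
      off-predense : ∀ δ i → ∃[ η ] ∃[ j ] (Off η j × Comparable η j δ i)
      off-predense δ i = go em
        where
        k : ∀ n → ∃[ k ] (e (next δ) k ≈[ next δ ] snoc δ (e δ i) (fin n))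
        k n = child δ i (fin<hat n)
        comparable : ∀ n → Comparable (next δ) (proj₁ (k n)) δ i
        comparable n = inj₂ (inj₁ <-next , λ ξ ξ<δ →
          sym (trans (proj₂ (k n) ξ (<-trans ξ<δ <-next)) (snoc-≈ ξ ξ<δ)))
        last : ∀ n {b} → dom b ≡ next δ → Matches b (proj₁ (k n)) →
               (δ<b : δ < dom b) → val b δ δ<b ≡ fin n
        last n refl matches δ<b = trans (matches δ δ<b) (trans (proj₂ (k n) δ δ<b) snoc-last)
        go : Dec (Off (next δ) (proj₁ (k 0))) → ∃[ η ] ∃[ j ] (Off η j × Comparable η j δ i)
        go (yes off) = next δ , proj₁ (k 0) , off , comparable 0
        go (no on)   = next δ , proj₁ (k 1) , off₁ , comparable 1
          where
          off₁ : Off (next δ) (proj₁ (k 1))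
          off₁ (b₁ , b₁∈B , dom₁ , matches₁) = on λ (b₀ , b₀∈B , dom₀ , matches₀) →
            let δ<b₀ = subst (δ <_) (sym dom₀) <-next
                δ<b₁ = subst (δ <_) (sym dom₁) <-next
            in <⇒≢ (fin-mono {0} {1} (ℕ.s≤s ℕ.z≤n)) (trans (sym (last 0 {b₀} dom₀ matches₀ δ<b₀)) (trans
                 (coherent-values {b₀} {b₁} b₀∈B b₁∈B δ δ<b₀ δ<b₁) (last 1 {b₁} dom₁ matches₁ δ<b₁)))

    -- At a sealed level the branch's own node extends some node off the branch; but the branch's
    -- node at that lower height coincides with it.
    no-cofinal-branch : ∀ B → ¬ CofinalBranch κ T B
    no-cofinal-branch B cofinal@(B⊆T , _ , levels-B)
      with Predense.sealing (Branch.Off B cofinal) (Branch.off-predense B cofinal)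
    ... | α , seal with levels-B α
    ... | b , b∈B , refl with B⊆T b∈B
    ... | i , matches with seal i
    ... | δ , j , δ<α , off , j≈i with levels-B δ
    ... | b′ , b′∈B , refl = off (b′ , b′∈B , refl , λ ξ ξ<δ →
      let ξ<α = <-trans ξ<δ δ<α in
      trans (Branch.coherent-values B cofinal {b′} {b} b′∈B b∈B ξ ξ<δ ξ<α)
        (trans (matches ξ ξ<α) (sym (j≈i ξ ξ<δ))))

    module BoundedAntichain (A : Pred (Seq κ) ℓ) (antichain : Antichain κ T A) where

      Compatible : Seq κ → Ord → Ord → Set ℓ
      Compatible a δ i = ∀ ξ (ξ<a : ξ < dom a) → ξ < δ → val a ξ ξ<a ≡ e δ i ξ

      -- Adding the nodes incompatible with all of `A` gives a predense set without extending `A` to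
      -- a maximal antichain.
      InOrIncompatible : Ord → Ord → Set ℓ
      InOrIncompatible δ i = (∃[ a ] (a ∈ A × dom a ≡ δ × Matches a i)) ⊎
                             (∀ a → a ∈ A → ¬ Compatible a δ i)

      predense : ∀ δ i → ∃[ η ] ∃[ j ] (InOrIncompatible η j × Comparable η j δ i)
      predense δ i with em {P = ∃[ a ] (a ∈ A × Compatible a δ i)}
      ... | no none = δ , i , inj₂ (λ a a∈A c → none (a , a∈A , c)) , inj₁ (≤-refl , λ _ _ → refl)
      ... | yes (a , a∈A , compatible) with proj₁ antichain a∈A
      ... | j , matches = dom a , j , inj₁ (a , a∈A , refl , matches) , comparable (<-≤-dec (dom a) δ)
        where
        comparable : dom a < δ ⊎ δ ≤ dom a → Comparable (dom a) j δ i
        comparable (inj₁ a<δ) = inj₁ (inj₁ a<δ , λ ξ ξ<a →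
          trans (sym (matches ξ ξ<a)) (compatible ξ ξ<a (<-trans ξ<a a<δ)))
        comparable (inj₂ δ≤a) = inj₂ (δ≤a , λ ξ ξ<δ → let ξ<a = <-≤-trans ξ<δ δ≤a in
          trans (sym (compatible ξ ξ<a ξ<δ)) (matches ξ ξ<a))

      -- A member of `A` reaching the sealed level would properly extend either another member or a
      -- node incompatible with it.
      bounded : ∃[ α ] (∀ a → a ∈ A → dom a < α)
      bounded with Predense.sealing InOrIncompatible predense
      ... | α , seal = α , λ a a∈A → ≰⇒> (unreachable a a∈A)
        where
        unreachable : ∀ a → a ∈ A → ¬ (α ≤ dom a)
        unreachable a a∈A α≤a with proj₁ antichain a∈A
        ... | i , matches with down (invariant (dom a)) i α α≤a
        ... | i′ , i′≈i with seal i′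
        ... | δ , j , δ<α , d , j≈i′ = refute d
          where
          δ<a : δ < dom a
          δ<a = <-≤-trans δ<α α≤a
          a≈j : ∀ ξ (ξ<a : ξ < dom a) → ξ < δ → val a ξ ξ<a ≡ e δ j ξ
          a≈j ξ ξ<a ξ<δ = trans (matches ξ ξ<a)
            (trans (sym (i′≈i ξ (<-trans ξ<δ δ<α))) (sym (j≈i′ ξ ξ<δ)))
          refute : ¬ InOrIncompatible δ j
          refute (inj₂ incompatible) = incompatible a a∈A a≈j
          refute (inj₁ (a′ , a′∈A , refl , matches′)) =
            proj₁ (proj₂ antichain a′ a a′∈A a∈A (λ a′≈a → <⇒≢ δ<a (≈ₛ⇒dom≡ {a′} {a} a′≈a)))
              (⊊-intro {a′} {a} δ<a (λ ξ ξ<a′ ξ<a → trans (matches′ ξ ξ<a′) (sym (a≈j ξ ξ<a ξ<a′))))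

    -- With heights below `α`, a member is determined by its height and index, hence by one ordinal
    -- below `hat α`; the bijection would then inject `κ` into `hat α`.
    no-κ-antichain : ∀ A → Antichain κ T A → ¬ (Subset (Seqₛ κ) A ≋ setoid Ord)
    no-κ-antichain A antichain@(A⊆T , _) bijection = proj₂ (cardinal (hat α)) (record
      { to        = λ ξ → pair α (dom (a ξ)) (index (a ξ)) , pair-< α (dom< ξ) (index<  ξ)
      ; cong      = λ { refl → refl }
      ; injective = λ {ξ} {η} eq →
          let pair≡ = trans (sym (unpair-pair α (dom< ξ) (index< ξ)))
                            (trans (cong (unpair α) eq) (unpair-pair α (dom< η) (index< η)))
          in trans (sym (to-a ξ)) (trans
               (B.cong {proj₁ (B.surjective ξ)} {proj₁ (B.surjective η)}
                 (index-injective {a ξ} {a η} (A⊆T (a∈A ξ)) (A⊆T (a∈A η)) (cong proj₁ pair≡) (cong proj₂ pair≡)))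
               (to-a η))
      })
      where
      module B = Bijection bijection
      bound : ∃[ α ] (∀ a → a ∈ A → dom a < α)
      bound = BoundedAntichain.bounded A antichain
      α : Ord
      α = proj₁ bound
      a : Ord → Seq κ
      a ξ = proj₁ (proj₁ (B.surjective ξ))
      a∈A : ∀ ξ → a ξ ∈ A
      a∈A ξ = proj₂ (proj₁ (B.surjective ξ))
      to-a : ∀ ξ → B.to (proj₁ (B.surjective ξ)) ≡ ξ
      to-a ξ = proj₂ (B.surjective ξ) {proj₁ (B.surjective ξ)} ((λ x → x) , (λ x → x))
      dom< : ∀ ξ → dom (a ξ) < hat α
      dom< ξ = <-≤-trans (proj₂ bound (a ξ) (a∈A ξ)) (≤-⊔ʳ _ _)
      index< : ∀ ξ → index (a ξ) < hat α
      index< ξ = <-≤-trans (index-< {a ξ} (A⊆T (a∈A ξ))) (hat-mono (inj₁ (proj₂ bound (a ξ) (a∈A ξ))))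

    souslin : Souslin κ T
    souslin = record
      { height-κ          = λ α → node α (e α zero) , (zero , λ _ _ → refl) , refl
      ; small-levels      = small-levels
      ; no-cofinal-branch = no-cofinal-branch
      ; no-κ-antichain    = no-κ-antichain
      }

theorem4p1 :
    (∀ {a} → ExcludedMiddle a) →
    ∀ {ℓ} (κ : RegularUncountableCardinal ℓ) →
    P₁₄ κ (_⊑_ κ) (𝟏 κ) (｛κ｝ κ) →
    Σ[ T ∈ Pred (Seq κ) ℓ ]
      (DownwardClosed κ T × Prolific κ T × Slim κ T × Souslin κ T ×
       ∃[ f ] (AscentPath κ 𝓕-fin T f × InjectivePath κ 𝓕-fin f))
theorem4p1 em κ ((C , club , coherent , proxy) , Z , _ , guess) =
  T , downwardClosed , prolific , slim , Sealing.souslin guess proxy , path-node , ascentPath , injectivePath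
  where open Construction em κ C club coherent Z
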